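{- Let $n\ge 2$ and $q$ a prime power. The association scheme $\mathcal X(GU(n,q),\Phi(n,q))$ is commutative (i.e., $p_{ij}^h=p_{ji}^h$ for all $h,i,j$) if and only if $q=2$.
   Context: $\Phi(n,q)=\{x\in\mathbb{F}_{q^2}^n\setminus\{0\}:\langle x,x\rangle=0\}$ with $\langle x,y\rangle=\sum_k x_k y_k^{\,q}$. $\mathcal X(GU(n,q),\Phi(n,q))$ is the Schurian association scheme on $\Phi(n,q)$ whose relations are the orbitals (orbits on $\Phi(n,q)\times\Phi(n,q)$) of $GU(n,q)=\{U\in GL_n(\mathbb{F}_{q^2}):U\bar U^T=I\}$ acting by $x\mapsto xU$. For relations $R_h,R_i,R_j$, $p_{ij}^h=|\{z:(x,z)\in R_i,(z,y)\in R_j\}|$ for any $(x,y)\in R_h$. -}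

module Defs where

open import Algebra.Bundles using (CommutativeRing; Semiring)
open import Algebra.Structures using (IsCommutativeRing)
import Algebra.Definitions.RawSemiring as RawSemiringDefs
open import Data.Bool.Base using (if_then_else_)
open import Data.Fin.Base using (Fin)
import Data.Fin.Properties as Fin
open import Data.List.Base using (List; []; _∷_; map; allFin; cartesianProductWith; filter; length)
open import Data.List.Membership.Propositional using (_∈_; lose; find)
open import Data.List.Membership.Propositional.Properties using (∈-map⁺; ∈-allFin; ∈-cartesianProductWith⁺)
open import Data.List.Relation.Unary.All using ([])
import Data.List.Relation.Unary.AllPairs as AllPairs
open import Data.List.Relation.Unary.Any using (here; any?)
open import Data.List.Relation.Unary.Unique.Propositional using (Unique)
import Data.List.Relation.Unary.Unique.Propositional.Properties as Unique
open import Data.Nat.Base as ℕ using (ℕ; zero; suc; _≤_)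
open import Data.Nat.Primality using (Prime)
open import Data.Product.Base using (∃-syntax; _×_; _,_)
open import Data.Vec.Base as Vec using (Vec; []; _∷_; lookup; tabulate)
import Data.Vec.Properties as Vec
open import Function.Bundles using (_↔_; Inverse)
open import Function.Properties.Inverse using (↔⇒↣)
open import Level using (0ℓ)
open import Relation.Binary.Definitions using (DecidableEquality)
open import Relation.Binary.PropositionalEquality using (_≡_; _≢_; refl; sym; trans; cong; subst)
open import Relation.Nullary.Decidable using (Dec; map′; _×-dec_; ¬?; does; via-injection)
open import Relation.Unary using (Pred; Decidable)

PrimePower : ℕ → Set
PrimePower q = ∃[ p ] ∃[ k ] (Prime p × 1 ≤ k × q ≡ p ℕ.^ k)

record FiniteField (m : ℕ) : Set₁ where
  infixl 6 _+_
  infixl 7 _*_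
  infix  8 -_
  infix  4 _≟_
  field
    Carrier           : Set
    _+_ _*_           : Carrier → Carrier → Carrier
    -_                : Carrier → Carrier
    0# 1#             : Carrier
    isCommutativeRing : IsCommutativeRing _≡_ _+_ _*_ -_ 0# 1#
    0≢1               : 0# ≢ 1#
    inverse           : ∀ x → x ≢ 0# → ∃[ y ] x * y ≡ 1#
    finite            : Carrier ↔ Fin m

  commutativeRing : CommutativeRing 0ℓ 0ℓ
  commutativeRing = record { isCommutativeRing = isCommutativeRing }

  open RawSemiringDefs (Semiring.rawSemiring (CommutativeRing.semiring commutativeRing)) public
    using (_^_; sum)

  _≟_ : DecidableEquality Carrier
  _≟_ = via-injection (↔⇒↣ finite) Fin._≟_

-- Duplicate-free exhaustive lists, so that cardinalities of decidable subsets
-- are lengths of filtered lists.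
record Enumeration (A : Set) : Set where
  field
    elements : List A
    unique   : Unique elements
    complete : ∀ x → x ∈ elements

  search : ∀ {P : Pred A 0ℓ} → Decidable P → Dec (∃[ x ] P x)
  search P? = map′ (λ p → let x , _ , px = find p in x , px)
                   (λ (x , px) → lose (complete x) px)
                   (any? P? elements)

  card : ∀ {P : Pred A 0ℓ} → Decidable P → ℕ
  card P? = length (filter P? elements)

open Enumeration using (elements; unique; complete; search; card)

fieldEnumeration : ∀ {m} (F : FiniteField m) → Enumeration (FiniteField.Carrier F)
fieldEnumeration {m} F = record
  { elements = map from (allFin m)
  ; unique   = Unique.map⁺ from-injective (Unique.allFin⁺ m)
  ; complete = λ x → subst (_∈ map from (allFin m)) (strictlyInverseʳ x)
                           (∈-map⁺ from (∈-allFin (to x)))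
  }
  where
  open Inverse (FiniteField.finite F)
  from-injective : ∀ {i j} → from i ≡ from j → i ≡ j
  from-injective {i} {j} eq =
    trans (sym (strictlyInverseˡ i)) (trans (cong to eq) (strictlyInverseˡ j))

vecEnumeration : ∀ {A} → Enumeration A → ∀ n → Enumeration (Vec A n)
vecEnumeration E zero = record
  { elements = [] ∷ []
  ; unique   = [] AllPairs.∷ AllPairs.[]
  ; complete = λ { [] → here refl }
  }
vecEnumeration E (suc n) = record
  { elements = cartesianProductWith _∷_ (elements E) (elements E′)
  ; unique   = Unique.cartesianProductWith⁺ _∷_ Vec.∷-injective (unique E) (unique E′)
  ; complete = λ { (x ∷ xs) → ∈-cartesianProductWith⁺ _∷_ (complete E x) (complete E′ xs) }
  }
  where
  E′ = vecEnumeration E n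

module UnitaryScheme (n q : ℕ) (F : FiniteField (q ℕ.^ 2)) where

  open FiniteField F

  infixl 7 _*ᴹ_ _·_
  infix  4 _≟ᵛ_ _≟ᴹ_

  Vector : Set
  Vector = Vec Carrier n

  Matrix : Set
  Matrix = Vec Vector n

  _≟ᵛ_ : DecidableEquality Vector
  _≟ᵛ_ = Vec.≡-dec _≟_

  _≟ᴹ_ : DecidableEquality Matrix
  _≟ᴹ_ = Vec.≡-dec _≟ᵛ_

  vectors : Enumeration Vector
  vectors = vecEnumeration (fieldEnumeration F) n

  matrices : Enumeration Matrix
  matrices = vecEnumeration vectors n

  0ᵛ : Vector
  0ᵛ = Vec.replicate n 0#

  _[_,_] : Matrix → Fin n → Fin n → Carrier
  U [ i , j ] = lookup (lookup U i) j

  matrix : (Fin n → Fin n → Carrier) → Matrix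
  matrix f = tabulate λ i → tabulate λ j → f i j

  1ᴹ : Matrix
  1ᴹ = matrix λ i j → if does (i Fin.≟ j) then 1# else 0#

  _*ᴹ_ : Matrix → Matrix → Matrix
  U *ᴹ V = matrix λ i j → sum λ k → U [ i , k ] * V [ k , j ]

  _·_ : Vector → Matrix → Vector
  x · U = tabulate λ j → sum λ k → lookup x k * U [ k , j ]

  conjugateTranspose : Matrix → Matrix
  conjugateTranspose U = matrix λ i j → U [ j , i ] ^ q

  ⟨_,_⟩ : Vector → Vector → Carrier
  ⟨ x , y ⟩ = sum λ k → lookup x k * lookup y k ^ q

  Φ : Pred Vector 0ℓ
  Φ x = x ≢ 0ᵛ × ⟨ x , x ⟩ ≡ 0#

  GL : Pred Matrix 0ℓ
  GL U = ∃[ V ] (U *ᴹ V ≡ 1ᴹ × V *ᴹ U ≡ 1ᴹ)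

  GU : Pred Matrix 0ℓ
  GU U = GL U × U *ᴹ conjugateTranspose U ≡ 1ᴹ

  -- An orbital is given by a representative pair; distinct representatives may
  -- name the same relation.
  record Orbital : Set where
    constructor orbital
    field
      {a b} : Vector
      a∈Φ   : Φ a
      b∈Φ   : Φ b

  R : Orbital → Vector → Vector → Set
  R o x y = ∃[ U ] (GU U × a · U ≡ x × b · U ≡ y)
    where open Orbital o

  Φ? : Decidable Φ
  Φ? x = ¬? (x ≟ᵛ 0ᵛ) ×-dec (⟨ x , x ⟩ ≟ 0#)

  GU? : Decidable GU
  GU? U = search matrices (λ V → (U *ᴹ V ≟ᴹ 1ᴹ) ×-dec (V *ᴹ U ≟ᴹ 1ᴹ))
          ×-dec (U *ᴹ conjugateTranspose U ≟ᴹ 1ᴹ)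

  R? : ∀ o x y → Dec (R o x y)
  R? o x y = search matrices λ U → GU? U ×-dec (a · U ≟ᵛ x) ×-dec (b · U ≟ᵛ y)
    where open Orbital o

  -- |{z ∈ Φ : (x,z) ∈ Rᵢ, (z,y) ∈ Rⱼ}|; this is p i j h when (x,y) ∈ R h.
  intersectionNumber : (i j : Orbital) (x y : Vector) → ℕ
  intersectionNumber i j x y = card vectors λ z → Φ? z ×-dec R? i x z ×-dec R? j z y

  Commutative : Set
  Commutative = ∀ (h i j : Orbital) x y → R h x y →
                intersectionNumber i j x y ≡ intersectionNumber j i x y

{-# OPTIONS --safe #-}

-- Suppose q > 2 and write N for the norm c ↦ c^(q+1). Some c ≠ 0 has N c ≠ 1, and there are
-- isotropic x, y with ⟨x,y⟩ ≠ 0. The orbitals of (x , c x) and (c x , y) do not commute: a path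
-- from x to y that uses them in the reverse order would force ⟨x,y⟩ = N c ⟨x,y⟩.
--
-- Suppose q = 2. It suffices that for isotropic x, y some unitary U takes (x̄ , ȳ) to (y , x), for
-- then z ↦ z̄ U reverses paths from x to y. At a coordinate where x and y are both zero or both
-- nonzero a diagonal matrix does this, since the norm of a nonzero element is 1. Let u collect the
-- remaining coordinates of x and y; it is isotropic, and it remains to take (y + u , x + u) to
-- (y , x). If ⟨x,u⟩ = 1 this is done by the transvection along u; if ⟨x,u⟩ = 0 and neither support
-- contains the other, by two transvections, the first along a vector of weight two. If one support
-- is strictly smaller, a reflection reduces to the previous case.

module Submission where

open import Algebra.Bundles using (CommutativeRing)
import Algebra.Properties.CommutativeMonoid.Sum as CommutativeMonoidSum
import Algebra.Properties.CommutativeSemiring.Binomial as Binomial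
import Algebra.Properties.CommutativeSemiring.Exp as CommutativeExp
import Algebra.Properties.Ring as RingProperties
import Algebra.Properties.Semiring.Exp as Exp
import Algebra.Properties.Semiring.Mult as Mult
import Algebra.Properties.Semiring.Sum as Sum
import Algebra.Solver.Ring as RingSolver
open import Algebra.Solver.Ring.AlmostCommutativeRing using (fromCommutativeRing; _-Raw-AlmostCommutative⟶_)
import Algebra.Solver.Ring.NaturalCoefficients.Default as SemiringSolver
open import Data.Bool.Base using (if_then_else_; Bool; true; false)
open import Data.Bool.Properties using (xor-∧-commutativeRing)
open import Data.Empty using (⊥-elim)
open import Data.Fin.Base as Fin using (Fin; zero; suc; toℕ; fromℕ; inject₁)
open import Data.Fin.Permutation using (Permutation; permutation)
import Data.Fin.Properties as Fin
open import Data.List.Base using (List; []; _∷_; length; allFin; filter; map; _++_)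
open import Data.List.Membership.Propositional using (find; _∈_)
open import Data.List.Membership.Propositional.Properties using (∈-filter⁺; ∈-filter⁻; ∈-∃++; ∈-map⁻; ∈-++⁺ˡ; ∈-++⁺ʳ; ∈-++⁻)
open import Data.List.Properties using (length-map; length-tabulate; length-++-sucʳ)
open import Data.List.Relation.Unary.All as All using (All; []; _∷_)
open import Data.List.Relation.Unary.All.Properties using (¬All⇒Any¬)
import Data.List.Relation.Unary.AllPairs as AllPairs
open import Data.List.Relation.Unary.Any using (here; there)
open import Data.List.Relation.Unary.Unique.Propositional using (Unique)
import Data.List.Relation.Unary.Unique.Propositional.Properties as Unique
open import Data.Maybe.Base using (Maybe; just; nothing)
open import Data.Nat.Base as ℕ using (ℕ; zero; suc; _≤_; _<_; z≤n; s≤s; _!; _∸_)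
open import Data.Nat.Combinatorics using (_C_; nCn≡1; nCk≡n!/k![n-k]!; k![n∸k]!∣n!)
open import Data.Nat.DivMod using (m/n*n≡m)
open import Data.Nat.Divisibility using (_∣_; divides; m∣m*n; ∣⇒≤)
open import Data.Nat.Primality using (Prime; euclidsLemma; prime⇒nonZero; prime⇒nonTrivial)
import Data.Nat.Properties as ℕ
open import Data.Nat.Solver using (module +-*-Solver)
open import Data.Product.Base using (∃-syntax; _×_; _,_; proj₁; proj₂)
open import Data.Sum.Base using (_⊎_; inj₁; inj₂)
open import Data.Vec.Base as Vec using (Vec; []; _∷_; lookup; tabulate; zipWith)
import Data.Vec.Properties as Vec
open import Function.Base using (_∘_; _$_)
open import Function.Bundles using (_⇔_; mk⇔; Inverse)
open import Level using (0ℓ)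
open import Relation.Binary.PropositionalEquality using (_≡_; _≢_; refl; sym; trans; cong; cong₂; subst; module ≡-Reasoning; subst₂)
open import Relation.Nullary.Decidable using (yes; no; does; _×-dec_; ¬?; decidable-stable)
open import Relation.Nullary.Negation using (¬_; contradiction)
open import Relation.Unary using (Pred; Decidable)
open import Defs

-- Conjugation reverses the form, ⟨x̄,ȳ⟩ = ⟨y,x⟩, so (x̄ , ȳ) and (y , x) have the same Gram matrix.
-- By Witt's theorem a unitary U between them exists as soon as linear relations are respected as
-- well. For independent x and y that is automatic; for y = c x it means N c = 1. This is how q
-- enters, and why the orbital of (x , c x) is the one that breaks commutativity when some norm is
-- neither 0 nor 1. In place of Witt's theorem the proof gives explicit maps, adapted to 𝔽₄: there
-- conjugation is squaring, every nonzero norm is 1, and the elements fixed by conjugation are 0 and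
-- 1. Hence ⟨x,u⟩, which is fixed, has only the two values treated. Also, an isotropic vector has an
-- even number of nonzero coordinates, and this parity supplies the additional coordinates on which
-- the reflection for nested supports is built.

-- Prime divisors of binomial coefficients

prime∤! : ∀ {p} → Prime p → ∀ k → k < p → ¬ p ∣ k !
prime∤! {p} pr zero    k<p p∣ = ℕ.<⇒≱ (ℕ.nonTrivial⇒n>1 p {{prime⇒nonTrivial pr}}) (∣⇒≤ p∣)
prime∤! {p} pr (suc k) k<p p∣ with euclidsLemma (suc k) (k !) pr p∣
... | inj₁ p∣k = ℕ.<⇒≱ k<p (∣⇒≤ p∣k)
... | inj₂ p∣! = prime∤! pr k (ℕ.<-trans (ℕ.n<1+n k) k<p) p∣!

-- `p` divides `p !`, which is the binomial coefficient times two factorials of numbers below `p`;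
-- Euclid's lemma leaves only the coefficient.
prime∣C : ∀ {p k} → Prime p → 0 < k → k < p → p ∣ p C k
prime∣C {p} {k} pr 0<k k<p with euclidsLemma (p C k) (k ! ℕ.* (p ∸ k) !) pr p∣C*d
  where
  instance _ = k ℕ.!* (p ∸ k) !≢0
  p∣p! : ∀ {p} → 0 < p → p ∣ p !
  p∣p! {suc p} _ = m∣m*n (p !)
  C*d≡p! : (p C k) ℕ.* (k ! ℕ.* (p ∸ k) !) ≡ p !
  C*d≡p! = trans (cong (ℕ._* (k ! ℕ.* (p ∸ k) !)) (nCk≡n!/k![n-k]! (ℕ.<⇒≤ k<p))) (m/n*n≡m (k![n∸k]!∣n! (ℕ.<⇒≤ k<p)))
  p∣C*d : p ∣ (p C k) ℕ.* (k ! ℕ.* (p ∸ k) !)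
  p∣C*d = subst (p ∣_) (sym C*d≡p!) (p∣p! (ℕ.<-trans 0<k k<p))
... | inj₁ p∣C = p∣C
... | inj₂ p∣d with euclidsLemma (k !) ((p ∸ k) !) pr p∣d
...   | inj₁ p∣k! = contradiction p∣k! (prime∤! pr k k<p)
...   | inj₂ p∣   = contradiction p∣ (prime∤! pr (p ∸ k) (ℕ.∸-monoʳ-< 0<k (ℕ.<⇒≤ k<p)))

-- Finite fields: cancellation, characteristic, Fermat, Frobenius

module FiniteFieldProperties {m : ℕ} (F : FiniteField m) where
  open FiniteField F
  open CommutativeRing commutativeRing using (semiring; commutativeSemiring; ring; *-commutativeMonoid; +-assoc; +-identityˡ; +-identityʳ; -‿inverseˡ; -‿inverseʳ; *-assoc; *-comm; *-identityˡ; *-identityʳ; distribˡ; zeroˡ; zeroʳ)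
  open Mult semiring using (×-assoc-*; ×1-homo-*; ×-homo-1) renaming (_×_ to infixr 8 _•_)
  open Exp semiring using (^-assocʳ)
  open Sum semiring using (sum-cong-≗; sum-permute; ∑-distrib-+; sum-replicate; sum-replicate-zero; sum-init-last)
  open RingProperties ring using (+-cancelˡ)
  open SemiringSolver commutativeSemiring using (solve; _:=_; _:+_; _:*_; con)
  open ≡-Reasoning
  private module Product = CommutativeMonoidSum *-commutativeMonoid

  0^ : ∀ {k} → 0 < k → 0# ^ k ≡ 0#
  0^ {suc k} _ = zeroˡ _

  1^ : ∀ k → 1# ^ k ≡ 1#
  1^ zero    = refl
  1^ (suc k) = trans (*-identityˡ _) (1^ k)

  *-cancelˡ : ∀ x {y z} → x ≢ 0# → x * y ≡ x * z → y ≡ z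
  *-cancelˡ x {y} {z} x≢0 eq = begin
    y             ≡⟨ undo y ⟩
    x⁻¹ * (x * y) ≡⟨ cong (x⁻¹ *_) eq ⟩
    x⁻¹ * (x * z) ≡⟨ undo z ⟨
    z             ∎
    where
    x⁻¹ = proj₁ (inverse x x≢0)
    undo : ∀ w → w ≡ x⁻¹ * (x * w)
    undo w = begin
      w               ≡⟨ *-identityˡ w ⟨
      1# * w          ≡⟨ cong (_* w) (proj₂ (inverse x x≢0)) ⟨
      (x * x⁻¹) * w   ≡⟨ solve 3 (λ a b c → a :* b :* c := b :* (a :* c)) refl x x⁻¹ w ⟩
      x⁻¹ * (x * w)   ∎

  x*y≡0⇒y≡0 : ∀ {x y} → x ≢ 0# → x * y ≡ 0# → y ≡ 0#
  x*y≡0⇒y≡0 {x} x≢0 eq = *-cancelˡ x x≢0 (trans eq (sym (zeroʳ x)))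

  *-nonzero : ∀ {x y} → x ≢ 0# → y ≢ 0# → x * y ≢ 0#
  *-nonzero x≢0 y≢0 eq = y≢0 (x*y≡0⇒y≡0 x≢0 eq)

  ^-nonzero : ∀ {x} k → x ≢ 0# → x ^ k ≢ 0#
  ^-nonzero zero    x≢0 eq = 0≢1 (sym eq)
  ^-nonzero (suc k) x≢0 eq = *-nonzero x≢0 (^-nonzero k x≢0) eq

  x^k≡0⇒x≡0 : ∀ {x} k → x ^ k ≡ 0# → x ≡ 0#
  x^k≡0⇒x≡0 {x} k eq with x ≟ 0#
  ... | yes x≡0 = x≡0
  ... | no  x≢0 = contradiction eq (^-nonzero k x≢0)

  open Inverse finite using (to; from; strictlyInverseˡ; strictlyInverseʳ)

  bijection⇒permutation : (f g : Carrier → Carrier) → (∀ x → f (g x) ≡ x) → (∀ x → g (f x) ≡ x) → Permutation m m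
  bijection⇒permutation f g fg gf = permutation (to ∘ f ∘ from) (to ∘ g ∘ from) (roundtrip f g fg) (roundtrip g f gf)
    where
    roundtrip : ∀ (f g : Carrier → Carrier) → (∀ x → f (g x) ≡ x) → ∀ i → to (f (from (to (g (from i))))) ≡ i
    roundtrip f g fg i = begin
      to (f (from (to (g (from i))))) ≡⟨ cong (to ∘ f) (strictlyInverseʳ (g (from i))) ⟩
      to (f (g (from i)))             ≡⟨ cong to (fg (from i)) ⟩
      to (from i)                     ≡⟨ strictlyInverseˡ i ⟩
      i                               ∎

  sum-field-bijection : ∀ (h f g : Carrier → Carrier) → (∀ x → f (g x) ≡ x) → (∀ x → g (f x) ≡ x) →
                        sum (h ∘ from) ≡ sum (h ∘ f ∘ from)
  sum-field-bijection h f g fg gf = trans (sum-permute (h ∘ from) (bijection⇒permutation f g fg gf))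
    (sum-cong-≗ λ i → cong h (strictlyInverseʳ (f (from i))))

  product-field-bijection : ∀ (h f g : Carrier → Carrier) → (∀ x → f (g x) ≡ x) → (∀ x → g (f x) ≡ x) →
                            Product.sum (h ∘ from) ≡ Product.sum (h ∘ f ∘ from)
  product-field-bijection h f g fg gf = trans (Product.sum-permute (h ∘ from) (bijection⇒permutation f g fg gf))
    (Product.sum-cong-≗ λ i → cong h (strictlyInverseʳ (f (from i))))

  -- Translation by `1#` permutes the field, so the sum of all elements equals itself plus `m • 1#`.
  m•1≡0 : m • 1# ≡ 0#
  m•1≡0 = sym $ +-cancelˡ (sum from) _ _ $ begin
    sum from + 0#                    ≡⟨ +-identityʳ _ ⟩
    sum from
      ≡⟨ sum-field-bijection (λ x → x) (_+ 1#) (_+ - 1#) (cancel (-‿inverseˡ 1#)) (cancel (-‿inverseʳ 1#)) ⟩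
    sum (λ i → from i + 1#)          ≡⟨ ∑-distrib-+ {m} from (λ _ → 1#) ⟩
    sum from + sum {m} (λ _ → 1#)    ≡⟨ cong (sum from +_) (sum-replicate m) ⟩
    sum from + m • 1#                ∎
    where
    cancel : ∀ {a b} → a + b ≡ 0# → ∀ x → (x + a) + b ≡ x
    cancel a+b≡0 x = trans (+-assoc x _ _) (trans (cong (x +_) a+b≡0) (+-identityʳ x))

  private
    -- Replacing 0 by 1 turns a product indexed by all of `Fin m` into the product of the nonzero
    -- elements, to which permutations of the whole field apply. `scale t` is the matching factor:
    -- `t` at every element except 0.
    unit : Carrier → Carrier
    unit x with x ≟ 0#
    ... | yes _ = 1#
    ... | no  _ = x

    unit-nonzero : ∀ x → unit x ≢ 0#
    unit-nonzero x with x ≟ 0#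
    ... | yes _   = 0≢1 ∘ sym
    ... | no  x≢0 = x≢0

    scale : Carrier → Carrier → Carrier
    scale t x with x ≟ 0#
    ... | yes _ = 1#
    ... | no  _ = t

    unit-* : ∀ {t} → t ≢ 0# → ∀ x → unit (t * x) ≡ scale t x * unit x
    unit-* {t} t≢0 x with x ≟ 0#
    unit-* {t} t≢0 x | yes x≡0 with t * x ≟ 0#
    ... | yes _ = sym (*-identityˡ 1#)
    ... | no ≢0 = contradiction (trans (cong (t *_) x≡0) (zeroʳ t)) ≢0
    unit-* {t} t≢0 x | no x≢0 with t * x ≟ 0#
    ... | yes ≡0 = contradiction ≡0 (*-nonzero t≢0 x≢0)
    ... | no _ = refl

    product-nonzero : ∀ {k} (f : Fin k → Carrier) → (∀ i → f i ≢ 0#) → Product.sum f ≢ 0#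
    product-nonzero {zero}  f f≢0 = 0≢1 ∘ sym
    product-nonzero {suc k} f f≢0 = *-nonzero (f≢0 zero) (product-nonzero (f ∘ suc) (f≢0 ∘ suc))

    -- Exactly one index is sent to 0 and contributes 1 instead of `t`; the factor `t` in front
    -- makes up for it.
    product-scale : ∀ {k} (f : Fin k → Carrier) t → (∀ {i j} → f i ≡ f j → i ≡ j) → (i : Fin k) → f i ≡ 0# →
                    t * Product.sum (scale t ∘ f) ≡ t ^ k
    product-scale {suc k} f t inj i fi≡0 = cong (t *_) $ begin
      Product.sum (scale t ∘ f)                                       ≡⟨ Product.sum-remove {i = i} (scale t ∘ f) ⟩
      scale t (f i) * Product.sum (λ j → scale t (f (Fin.punchIn i j)))
        ≡⟨ cong₂ _*_ at-zero (trans (Product.sum-cong-≗ elsewhere) (Product.sum-replicate k)) ⟩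
      1# * t ^ k                                                      ≡⟨ *-identityˡ _ ⟩
      t ^ k                                                           ∎
      where
      at-zero : scale t (f i) ≡ 1#
      at-zero with f i ≟ 0#
      ... | yes _ = refl
      ... | no ≢0 = contradiction fi≡0 ≢0
      elsewhere : ∀ j → scale t (f (Fin.punchIn i j)) ≡ t
      elsewhere j with f (Fin.punchIn i j) ≟ 0#
      ... | yes ≡0 = contradiction (inj (trans ≡0 (sym fi≡0))) (Fin.punchInᵢ≢i i j)
      ... | no _   = refl

  -- Multiplication by t permutes the nonzero elements, so it leaves their product unchanged.
  fermat : ∀ t → 0 < m → t ^ m ≡ t
  fermat t 0<m with t ≟ 0#
  ... | yes refl = 0^ 0<m
  ... | no t≢0 = begin
    t ^ m                               ≡⟨ product-scale from t from-injective (to 0#) (strictlyInverseʳ 0#) ⟨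
    t * Product.sum (scale t ∘ from)    ≡⟨ cong (t *_) ∏scale≡1 ⟩
    t * 1#                              ≡⟨ *-identityʳ t ⟩
    t                                   ∎
    where
    t⁻¹ = proj₁ (inverse t t≢0)
    tt⁻¹ = proj₂ (inverse t t≢0)
    from-injective : ∀ {i j} → from i ≡ from j → i ≡ j
    from-injective {i} {j} eq = trans (sym (strictlyInverseˡ i)) (trans (cong to eq) (strictlyInverseˡ j))
    cancel : ∀ {a b} → a * b ≡ 1# → ∀ x → a * (b * x) ≡ x
    cancel ab x = trans (sym (*-assoc _ _ x)) (trans (cong (_* x) ab) (*-identityˡ x))
    ∏ = Product.sum (unit ∘ from)
    ∏scale≡1 : Product.sum (scale t ∘ from) ≡ 1#
    ∏scale≡1 = *-cancelˡ ∏ (product-nonzero (unit ∘ from) (unit-nonzero ∘ from)) $ begin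
      ∏ * Product.sum (scale t ∘ from)                        ≡⟨ *-comm ∏ _ ⟩
      Product.sum (scale t ∘ from) * ∏                        ≡⟨ Product.∑-distrib-+ (scale t ∘ from) (unit ∘ from) ⟨
      Product.sum (λ i → scale t (from i) * unit (from i))    ≡⟨ Product.sum-cong-≗ (λ i → unit-* t≢0 (from i)) ⟨
      Product.sum (λ i → unit (t * from i))
        ≡⟨ product-field-bijection unit (t *_) (t⁻¹ *_) (cancel tt⁻¹) (cancel (trans (*-comm t⁻¹ t) tt⁻¹)) ⟨
      ∏                                                       ≡⟨ *-identityʳ ∏ ⟨
      ∏ * 1#                                                  ∎

  •1-^ : ∀ p k → (p ℕ.^ k) • 1# ≡ (p • 1#) ^ k
  •1-^ p zero    = ×-homo-1 1#
  •1-^ p (suc k) = trans (×1-homo-* p (p ℕ.^ k)) (cong ((p • 1#) *_) (•1-^ p k))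

  -- `m • 1#` is a power of `p • 1#`, and a field has no nonzero nilpotents.
  p•1≡0 : ∀ p k → m ≡ p ℕ.^ k → p • 1# ≡ 0#
  p•1≡0 p k m≡p^k = x^k≡0⇒x≡0 k (trans (sym (•1-^ p k)) (trans (cong (_• 1#) (sym m≡p^k)) m•1≡0))

  ∣⇒•≡0 : ∀ {p c} → p • 1# ≡ 0# → p ∣ c → ∀ x → c • x ≡ 0#
  ∣⇒•≡0 {p} p≡0 (divides r refl) x = begin
    (r ℕ.* p) • x               ≡⟨ cong ((r ℕ.* p) •_) (*-identityˡ x) ⟨
    (r ℕ.* p) • (1# * x)        ≡⟨ ×-assoc-* (r ℕ.* p) 1# x ⟨
    ((r ℕ.* p) • 1#) * x        ≡⟨ cong (_* x) (×1-homo-* r p) ⟩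
    ((r • 1#) * (p • 1#)) * x   ≡⟨ cong (λ z → ((r • 1#) * z) * x) p≡0 ⟩
    ((r • 1#) * 0#) * x         ≡⟨ cong (_* x) (zeroʳ _) ⟩
    0# * x                      ≡⟨ zeroˡ x ⟩
    0#                          ∎

  -- Every binomial coefficient strictly between the two ends is a multiple of `p`, hence kills its
  -- term.
  frobenius-+ : ∀ {p} → Prime p → p • 1# ≡ 0# → ∀ x y → (x + y) ^ p ≡ x ^ p + y ^ p
  frobenius-+ {zero}  pr = ⊥-elim (ℕ.≢-nonZero⁻¹ 0 {{prime⇒nonZero pr}} refl)
  frobenius-+ {p@(suc p-1)} pr p≡0 x y = begin
    (x + y) ^ p                                       ≡⟨ Binomial.theorem commutativeSemiring p x y ⟩
    sum term                                          ≡⟨ sum-init-last term ⟩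
    (term zero + sum (λ i → term (inject₁ (suc i)))) + term (fromℕ p)
                                                      ≡⟨ cong₂ _+_ (cong₂ _+_ first (trans (sum-cong-≗ middle) (sum-replicate-zero p-1))) last ⟩
    (y ^ p + 0#) + x ^ p
      ≡⟨ solve 2 (λ a b → a :+ con 0 :+ b := b :+ a) refl (y ^ p) (x ^ p) ⟩
    x ^ p + y ^ p                                     ∎
    where
    term : Fin (suc p) → Carrier
    term k = (p C toℕ k) • (x ^ toℕ k * y ^ (p ∸ toℕ k))
    first : term zero ≡ y ^ p
    first = trans (×-homo-1 _) (*-identityˡ _)
    last : term (fromℕ p) ≡ x ^ p
    last = begin
      term (fromℕ p)                    ≡⟨ cong (λ k → (p C k) • (x ^ k * y ^ (p ∸ k))) (Fin.toℕ-fromℕ p) ⟩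
      (p C p) • (x ^ p * y ^ (p ∸ p))   ≡⟨ cong₂ (λ c k → c • (x ^ p * y ^ k)) (nCn≡1 p) (ℕ.n∸n≡0 p) ⟩
      1 • (x ^ p * 1#)                  ≡⟨ trans (×-homo-1 _) (*-identityʳ _) ⟩
      x ^ p                             ∎
    middle : ∀ i → term (inject₁ (suc i)) ≡ 0#
    middle i =
      ∣⇒•≡0 {p} p≡0 (prime∣C pr (s≤s z≤n) (subst (_< p) (sym (Fin.toℕ-inject₁ (suc i))) (Fin.toℕ<n (suc i)))) _

  frobenius-^-+ : ∀ {p} → Prime p → p • 1# ≡ 0# → ∀ k x y → (x + y) ^ (p ℕ.^ k) ≡ x ^ (p ℕ.^ k) + y ^ (p ℕ.^ k)
  frobenius-^-+ {p} pr p≡0 zero x y = solve 2 (λ a b → (a :+ b) :* con 1 := a :* con 1 :+ b :* con 1) refl x y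
  frobenius-^-+ {p} pr p≡0 (suc k) x y = begin
    (x + y) ^ (p ℕ.* r)         ≡⟨ ^-assocʳ (x + y) p r ⟨
    ((x + y) ^ p) ^ r           ≡⟨ cong (_^ r) (frobenius-+ pr p≡0 x y) ⟩
    (x ^ p + y ^ p) ^ r         ≡⟨ frobenius-^-+ pr p≡0 k (x ^ p) (y ^ p) ⟩
    (x ^ p) ^ r + (y ^ p) ^ r   ≡⟨ cong₂ _+_ (^-assocʳ x p r) (^-assocʳ y p r) ⟩
    x ^ (p ℕ.* r) + y ^ (p ℕ.* r) ∎
    where r = p ℕ.^ k

  -- Roots of monic polynomials

  x-y≡0⇒x≡y : ∀ {x y} → x + - y ≡ 0# → x ≡ y
  x-y≡0⇒x≡y {x} {y} eq = begin
    x               ≡⟨ +-identityʳ x ⟨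
    x + 0#          ≡⟨ cong (x +_) (-‿inverseˡ y) ⟨
    x + (- y + y)   ≡⟨ +-assoc x (- y) y ⟨
    (x + - y) + y   ≡⟨ cong (_+ y) eq ⟩
    0# + y          ≡⟨ +-identityˡ y ⟩
    y               ∎

  -- A monic polynomial of degree d is given by its d lower coefficients, constant term first.
  eval : ∀ {d} → Vec Carrier d → Carrier → Carrier
  eval []       x = 1#
  eval (c ∷ cs) x = c + x * eval cs x

  -- Synthetic division by `X - a`: the Horner values of the tails at `a` are the coefficients. The
  -- quotient is again monic, so its leading 1 stays implicit.
  quotient : ∀ {d} → Carrier → Vec Carrier (suc d) → Vec Carrier d
  quotient a (c ∷ [])          = []
  quotient a (c ∷ cs@(_ ∷ _))  = eval cs a ∷ quotient a cs

  eval-quotient : ∀ {d} a (cs : Vec Carrier (suc d)) x →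
                  eval cs x ≡ eval cs a + (x + - a) * eval (quotient a cs) x
  eval-quotient a cs x =
    -- Writing `x` as `a + δ` removes subtraction from the induction, which then consists of
    -- semiring identities.
    subst (λ z → eval cs z ≡ eval cs a + (x + - a) * eval (quotient a cs) z) split (go (x + - a) cs)
    where
    split : a + (x + - a) ≡ x
    split = begin
      a + (x + - a)  ≡⟨ solve 3 (λ a b c → a :+ (b :+ c) := b :+ (c :+ a)) refl a x (- a) ⟩
      x + (- a + a)  ≡⟨ cong (x +_) (-‿inverseˡ a) ⟩
      x + 0#         ≡⟨ +-identityʳ x ⟩
      x              ∎
    go : ∀ {d} δ (cs : Vec Carrier (suc d)) → eval cs (a + δ) ≡ eval cs a + δ * eval (quotient a cs) (a + δ)
    go δ (c ∷ [])          = solve 3 (λ c a δ → c :+ (a :+ δ) :* con 1 := c :+ a :* con 1 :+ δ :* con 1) refl c a δ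
    go δ (c ∷ cs@(_ ∷ _))  = trans (cong (λ e → c + (a + δ) * e) (go δ cs))
      (solve 5 (λ c a δ e g → c :+ (a :+ δ) :* (e :+ δ :* g) := c :+ a :* e :+ δ :* (e :+ (a :+ δ) :* g)) refl
         c a δ (eval cs a) (eval (quotient a cs) (a + δ)))

  -- Divide off the root `a`: the other roots differ from it, so they are roots of the quotient. In
  -- degree 0 only the constant 1 is left, which has no root.
  roots-length≤degree : ∀ {d} (cs : Vec Carrier d) {xs} → Unique xs → All (λ x → eval cs x ≡ 0#) xs → length xs ≤ d
  roots-length≤degree cs       {[]}     _ _ = z≤n
  roots-length≤degree []       {x ∷ xs} _ (root ∷ _) = contradiction (sym root) 0≢1
  roots-length≤degree cs@(_ ∷ _) {a ∷ xs} (a∉ AllPairs.∷ uniq) (root ∷ roots) =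
    s≤s (roots-length≤degree (quotient a cs) uniq (All.zipWith quotient-root (a∉ , roots)))
    where
    quotient-root : ∀ {x} → (a ≢ x) × (eval cs x ≡ 0#) → eval (quotient a cs) x ≡ 0#
    quotient-root {x} (a≢x , x-root) = x*y≡0⇒y≡0 (λ eq → a≢x (sym (x-y≡0⇒x≡y eq))) $ begin
      (x + - a) * eval (quotient a cs) x               ≡⟨ +-identityˡ _ ⟨
      0# + (x + - a) * eval (quotient a cs) x          ≡⟨ cong (_+ (x + - a) * eval (quotient a cs) x) root ⟨
      eval cs a + (x + - a) * eval (quotient a cs) x   ≡⟨ eval-quotient a cs x ⟨
      eval cs x                                        ≡⟨ x-root ⟩
      0#                                               ∎

  -- Otherwise all `m` elements would be roots of `X ^ k - X`, of degree below `m`. The nontrivial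
  -- scalars of the proof come from here: `t ^ suc k ≢ t` says both that `t` is nonzero and that
  -- `t ^ k` is not 1.
  ∃-^≢ : ∀ k → 2 ≤ k → k < m → ∃[ t ] t ^ k ≢ t
  ∃-^≢ (suc zero) (s≤s ()) _
  ∃-^≢ k@(suc (suc d)) _ k<m with All.all? (λ t → t ^ k ≟ t) elements
    where open Enumeration (fieldEnumeration F)
  ... | yes all =
    contradiction (subst (_≤ k) length≡m (roots-length≤degree poly (Enumeration.unique (fieldEnumeration F)) (All.map root all))) (ℕ.<⇒≱ k<m)
    where
    poly : Vec Carrier k
    poly = 0# ∷ - 1# ∷ Vec.replicate d 0#
    eval-0s : ∀ d x → eval (Vec.replicate d 0#) x ≡ x ^ d
    eval-0s zero    x = refl
    eval-0s (suc d) x = trans (+-identityˡ _) (cong (x *_) (eval-0s d x))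
    root : ∀ {x} → x ^ k ≡ x → eval poly x ≡ 0#
    root {x} x^k≡x = begin
      0# + x * (- 1# + x * eval (Vec.replicate d 0#) x)  ≡⟨ cong (λ z → 0# + x * (- 1# + x * z)) (eval-0s d x) ⟩
      0# + x * (- 1# + x * x ^ d)
        ≡⟨ solve 3 (λ x n y → con 0 :+ x :* (n :+ y) := x :* y :+ x :* n) refl x (- 1#) (x * x ^ d) ⟩
      x ^ k + x * - 1#                                   ≡⟨ cong (_+ x * - 1#) (trans x^k≡x (sym (*-identityʳ x))) ⟩
      x * 1# + x * - 1#                                  ≡⟨ distribˡ x 1# (- 1#) ⟨
      x * (1# + - 1#)                                    ≡⟨ cong (x *_) (-‿inverseʳ 1#) ⟩
      x * 0#                                             ≡⟨ zeroʳ x ⟩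
      0#                                                 ∎
    length≡m : length (Enumeration.elements (fieldEnumeration F)) ≡ m
    length≡m = trans (length-map from (allFin m)) (length-tabulate {n = m} (λ i → i))
  ... | no ¬all = let t , _ , t^k≢t = find (¬All⇒Any¬ (λ t → t ^ k ≟ t) _ ¬all) in t , t^k≢t

-- Vectors, the Hermitian form and the unitary group

lookup-injective : ∀ {A : Set} {n} {x y : Vec A n} → (∀ i → lookup x i ≡ lookup y i) → x ≡ y
lookup-injective {x =
  x} {y} eq = trans (sym (Vec.tabulate∘lookup x)) (trans (Vec.tabulate-cong eq) (Vec.tabulate∘lookup y))

module UnitaryGeometry (n q : ℕ) (F : FiniteField (q ℕ.^ 2)) (0<q : 0 < q)
  (conj-+ : ∀ x y → FiniteField._^_ F (FiniteField._+_ F x y) q ≡ FiniteField._+_ F (FiniteField._^_ F x q) (FiniteField._^_ F y q))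
  (conj-conj : ∀ x → FiniteField._^_ F (FiniteField._^_ F x q) q ≡ x)
  where
  open FiniteField F
  open FiniteFieldProperties F
  open UnitaryScheme n q F
  open CommutativeRing commutativeRing using (semiring; commutativeSemiring; +-identityʳ; *-assoc; *-comm; *-identityˡ; *-identityʳ; distribʳ; zeroˡ; zeroʳ)
  open CommutativeExp commutativeSemiring using (^-distrib-*)
  open Sum semiring using (sum-cong-≗; ∑-distrib-+; ∑-comm; *-distribˡ-sum; *-distribʳ-sum; sum-remove; sum-replicate-zero)
  open SemiringSolver commutativeSemiring using (solve; _:=_; _:+_; _:*_; con)
  open ≡-Reasoning

  infixl 6 _+ᵛ_
  infixr 7 _*ᵛ_

  _+ᵛ_ : Vector → Vector → Vector
  _+ᵛ_ = zipWith _+_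

  _*ᵛ_ : Carrier → Vector → Vector
  c *ᵛ x = Vec.map (c *_) x

  conj : Vector → Vector
  conj = Vec.map (_^ q)

  δ : Fin n → Fin n → Carrier
  δ i j = if does (i Fin.≟ j) then 1# else 0#

  e : Fin n → Vector
  e i = lookup 1ᴹ i

  δ-refl : ∀ i → δ i i ≡ 1#
  δ-refl i with i Fin.≟ i
  ... | yes _   = refl
  ... | no  i≢i = contradiction refl i≢i

  δ-distinct : ∀ {i j} → i ≢ j → δ i j ≡ 0#
  δ-distinct {i} {j} i≢j with i Fin.≟ j
  ... | yes i≡j = contradiction i≡j i≢j
  ... | no  _   = refl

  lookup-+ᵛ : ∀ x y i → lookup (x +ᵛ y) i ≡ lookup x i + lookup y i
  lookup-+ᵛ x y i = Vec.lookup-zipWith _+_ i x y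

  lookup-*ᵛ : ∀ c x i → lookup (c *ᵛ x) i ≡ c * lookup x i
  lookup-*ᵛ c x i = Vec.lookup-map i (c *_) x

  lookup-conj : ∀ x i → lookup (conj x) i ≡ lookup x i ^ q
  lookup-conj x i = Vec.lookup-map i (_^ q) x

  lookup-matrix : ∀ f i j → matrix f [ i , j ] ≡ f i j
  lookup-matrix f i j =
    trans (cong (λ r → lookup r j) (Vec.lookup∘tabulate (λ i → tabulate (f i)) i)) (Vec.lookup∘tabulate (f i) j)

  lookup-e : ∀ i j → lookup (e i) j ≡ δ i j
  lookup-e = lookup-matrix δ

  lookup-· : ∀ x U j → lookup (x · U) j ≡ sum λ k → lookup x k * U [ k , j ]
  lookup-· x U j = Vec.lookup∘tabulate (λ j → sum λ k → lookup x k * U [ k , j ]) j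

  row-*ᴹ : ∀ U V i → lookup (U *ᴹ V) i ≡ lookup U i · V
  row-*ᴹ U V i = Vec.lookup∘tabulate _ i

  sum-support : ∀ {k} (f : Fin k → Carrier) i → (∀ j → j ≢ i → f j ≡ 0#) → sum f ≡ f i
  sum-support {suc k} f i f≡0 = begin
    sum f                                        ≡⟨ sum-remove {i = i} f ⟩
    f i + sum (λ j → f (Fin.punchIn i j))        ≡⟨ cong (f i +_) (sum-cong-≗ λ j → f≡0 _ (Fin.punchInᵢ≢i i j)) ⟩
    f i + sum {k} (λ _ → 0#)                     ≡⟨ cong (f i +_) (sum-replicate-zero k) ⟩
    f i + 0#                                     ≡⟨ +-identityʳ (f i) ⟩
    f i                                          ∎

  sum-*δ : ∀ (f : Fin n → Carrier) i → sum (λ k → f k * δ k i) ≡ f i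
  sum-*δ f i = begin
    sum (λ k → f k * δ k i)
      ≡⟨ sum-support (λ k → f k * δ k i) i (λ k k≢i → trans (cong (f k *_) (δ-distinct k≢i)) (zeroʳ (f k))) ⟩
    f i * δ i i             ≡⟨ cong (f i *_) (δ-refl i) ⟩
    f i * 1#                ≡⟨ *-identityʳ (f i) ⟩
    f i                     ∎

  sum-δ* : ∀ (f : Fin n → Carrier) i → sum (λ k → δ i k * f k) ≡ f i
  sum-δ* f i = begin
    sum (λ k → δ i k * f k)
      ≡⟨ sum-support (λ k → δ i k * f k) i (λ k k≢i → trans (cong (_* f k) (δ-distinct (k≢i ∘ sym))) (zeroˡ (f k))) ⟩
    δ i i * f i             ≡⟨ cong (_* f i) (δ-refl i) ⟩
    1# * f i                ≡⟨ *-identityˡ (f i) ⟩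
    f i                     ∎

  conj-sum : ∀ {k} (f : Fin k → Carrier) → sum f ^ q ≡ sum (λ i → f i ^ q)
  conj-sum {zero}  f = 0^ 0<q
  conj-sum {suc k} f = trans (conj-+ (f zero) _) (cong (f zero ^ q +_) (conj-sum (f ∘ suc)))

  ·-assoc : ∀ x U V → x · (U *ᴹ V) ≡ x · U · V
  ·-assoc x U V = Vec.tabulate-cong λ j → begin
    sum (λ k → lookup x k * (U *ᴹ V) [ k , j ])
      ≡⟨ sum-cong-≗ (λ k → cong (lookup x k *_) (lookup-matrix (λ k j → sum λ l → U [ k , l ] * V [ l , j ]) k j)) ⟩
    sum (λ k → lookup x k * sum (λ l → U [ k , l ] * V [ l , j ]))
      ≡⟨ sum-cong-≗ (λ k → *-distribˡ-sum (lookup x k) (λ l → U [ k , l ] * V [ l , j ])) ⟩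
    sum (λ k → sum λ l → lookup x k * (U [ k , l ] * V [ l , j ]))
      ≡⟨ ∑-comm (λ k l → lookup x k * (U [ k , l ] * V [ l , j ])) ⟩
    sum (λ l → sum λ k → lookup x k * (U [ k , l ] * V [ l , j ]))
      ≡⟨ sum-cong-≗ (λ l → sum-cong-≗ λ k → sym (*-assoc (lookup x k) (U [ k , l ]) (V [ l , j ]))) ⟩
    sum (λ l → sum λ k → (lookup x k * U [ k , l ]) * V [ l , j ])
      ≡⟨ sum-cong-≗ (λ l → *-distribʳ-sum (V [ l , j ]) (λ k → lookup x k * U [ k , l ])) ⟨
    sum (λ l → sum (λ k → lookup x k * U [ k , l ]) * V [ l , j ])
      ≡⟨ sum-cong-≗ (λ l → cong (_* V [ l , j ]) (sym (lookup-· x U l))) ⟩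
    sum (λ l → lookup (x · U) l * V [ l , j ]) ∎

  ·-identity : ∀ x → x · 1ᴹ ≡ x
  ·-identity x = lookup-injective λ j → begin
    lookup (x · 1ᴹ) j                      ≡⟨ lookup-· x 1ᴹ j ⟩
    sum (λ k → lookup x k * 1ᴹ [ k , j ])  ≡⟨ sum-cong-≗ (λ k → cong (lookup x k *_) (lookup-matrix δ k j)) ⟩
    sum (λ k → lookup x k * δ k j)         ≡⟨ sum-*δ (lookup x) j ⟩
    lookup x j                             ∎

  *ᴹ-assoc : ∀ U V W → U *ᴹ V *ᴹ W ≡ U *ᴹ (V *ᴹ W)
  *ᴹ-assoc U V W = lookup-injective λ i → begin
    lookup (U *ᴹ V *ᴹ W) i      ≡⟨ row-*ᴹ (U *ᴹ V) W i ⟩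
    lookup (U *ᴹ V) i · W       ≡⟨ cong (_· W) (row-*ᴹ U V i) ⟩
    lookup U i · V · W          ≡⟨ ·-assoc (lookup U i) V W ⟨
    lookup U i · (V *ᴹ W)       ≡⟨ row-*ᴹ U (V *ᴹ W) i ⟨
    lookup (U *ᴹ (V *ᴹ W)) i    ∎

  *ᴹ-identityʳ : ∀ U → U *ᴹ 1ᴹ ≡ U
  *ᴹ-identityʳ U = lookup-injective λ i → trans (row-*ᴹ U 1ᴹ i) (·-identity (lookup U i))

  form-+ˡ : ∀ x y z → ⟨ x +ᵛ y , z ⟩ ≡ ⟨ x , z ⟩ + ⟨ y , z ⟩
  form-+ˡ x y z = trans
    (sum-cong-≗ λ k → trans (cong (_* lookup z k ^ q) (lookup-+ᵛ x y k)) (distribʳ _ (lookup x k) (lookup y k)))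
    (∑-distrib-+ (λ k → lookup x k * lookup z k ^ q) (λ k → lookup y k * lookup z k ^ q))

  form-*ˡ : ∀ c x z → ⟨ c *ᵛ x , z ⟩ ≡ c * ⟨ x , z ⟩
  form-*ˡ c x z = trans
    (sum-cong-≗ λ k → trans (cong (_* lookup z k ^ q) (lookup-*ᵛ c x k)) (*-assoc c (lookup x k) _))
    (sym (*-distribˡ-sum c (λ k → lookup x k * lookup z k ^ q)))

  form-conj : ∀ x y → ⟨ y , x ⟩ ≡ ⟨ x , y ⟩ ^ q
  form-conj x y = sym $ trans (conj-sum (λ k → lookup x k * lookup y k ^ q)) $ sum-cong-≗ λ k → begin
    (lookup x k * lookup y k ^ q) ^ q        ≡⟨ ^-distrib-* (lookup x k) _ q ⟩
    lookup x k ^ q * (lookup y k ^ q) ^ q    ≡⟨ cong (lookup x k ^ q *_) (conj-conj (lookup y k)) ⟩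
    lookup x k ^ q * lookup y k              ≡⟨ *-comm _ _ ⟩
    lookup y k * lookup x k ^ q              ∎

  form-+ʳ : ∀ x y z → ⟨ z , x +ᵛ y ⟩ ≡ ⟨ z , x ⟩ + ⟨ z , y ⟩
  form-+ʳ x y z = begin
    ⟨ z , x +ᵛ y ⟩                     ≡⟨ form-conj (x +ᵛ y) z ⟩
    ⟨ x +ᵛ y , z ⟩ ^ q                 ≡⟨ cong (_^ q) (form-+ˡ x y z) ⟩
    (⟨ x , z ⟩ + ⟨ y , z ⟩) ^ q        ≡⟨ conj-+ _ _ ⟩
    ⟨ x , z ⟩ ^ q + ⟨ y , z ⟩ ^ q      ≡⟨ cong₂ _+_ (form-conj x z) (form-conj y z) ⟨
    ⟨ z , x ⟩ + ⟨ z , y ⟩              ∎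

  form-*ʳ : ∀ c x z → ⟨ z , c *ᵛ x ⟩ ≡ c ^ q * ⟨ z , x ⟩
  form-*ʳ c x z = begin
    ⟨ z , c *ᵛ x ⟩         ≡⟨ form-conj (c *ᵛ x) z ⟩
    ⟨ c *ᵛ x , z ⟩ ^ q     ≡⟨ cong (_^ q) (form-*ˡ c x z) ⟩
    (c * ⟨ x , z ⟩) ^ q    ≡⟨ ^-distrib-* c _ q ⟩
    c ^ q * ⟨ x , z ⟩ ^ q  ≡⟨ cong (c ^ q *_) (form-conj x z) ⟨
    c ^ q * ⟨ z , x ⟩      ∎

  form-eˡ : ∀ i z → ⟨ e i , z ⟩ ≡ lookup z i ^ q
  form-eˡ i z = trans (sum-cong-≗ λ k → cong (_* lookup z k ^ q) (lookup-e i k)) (sum-δ* (λ k → lookup z k ^ q) i)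

  form-eʳ : ∀ i z → ⟨ z , e i ⟩ ≡ lookup z i
  form-eʳ i z = trans (form-conj (e i) z) (trans (cong (_^ q) (form-eˡ i z)) (conj-conj (lookup z i)))

  form-e : ∀ i j → ⟨ e i , e j ⟩ ≡ δ i j
  form-e i j = trans (form-eʳ j (e i)) (lookup-e i j)

  -- Conjugation is an isometry up to exchanging the arguments; this is what allows a conjugated
  -- path to be read backwards.
  form-conjugates : ∀ x y → ⟨ conj x , conj y ⟩ ≡ ⟨ y , x ⟩
  form-conjugates x y = sum-cong-≗ λ k → begin
    lookup (conj x) k * lookup (conj y) k ^ q    ≡⟨ cong₂ (λ a b → a * b ^ q) (lookup-conj x k) (lookup-conj y k) ⟩
    lookup x k ^ q * (lookup y k ^ q) ^ q        ≡⟨ cong (lookup x k ^ q *_) (conj-conj (lookup y k)) ⟩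
    lookup x k ^ q * lookup y k                  ≡⟨ *-comm _ _ ⟩
    lookup y k * lookup x k ^ q                  ∎

  form-·ˡ : ∀ x U z → ⟨ x · U , z ⟩ ≡ sum λ k → lookup x k * ⟨ lookup U k , z ⟩
  form-·ˡ x U z = begin
    sum (λ j → lookup (x · U) j * lookup z j ^ q)
      ≡⟨ sum-cong-≗ (λ j → cong (_* lookup z j ^ q) (lookup-· x U j)) ⟩
    sum (λ j → sum (λ k → lookup x k * U [ k , j ]) * lookup z j ^ q)
      ≡⟨ sum-cong-≗ (λ j → *-distribʳ-sum (lookup z j ^ q) (λ k → lookup x k * U [ k , j ])) ⟩
    sum (λ j → sum λ k → lookup x k * U [ k , j ] * lookup z j ^ q)
      ≡⟨ ∑-comm (λ j k → lookup x k * U [ k , j ] * lookup z j ^ q) ⟩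
    sum (λ k → sum λ j → lookup x k * U [ k , j ] * lookup z j ^ q)
      ≡⟨ sum-cong-≗ (λ k → trans (sum-cong-≗ λ j → *-assoc (lookup x k) (U [ k , j ]) _) (sym (*-distribˡ-sum (lookup x k) (λ j → U [ k , j ] * lookup z j ^ q)))) ⟩
    sum (λ k → lookup x k * ⟨ lookup U k , z ⟩) ∎

  Orthonormal : Matrix → Set
  Orthonormal U = ∀ i j → ⟨ lookup U i , lookup U j ⟩ ≡ δ i j

  gram-entry : ∀ U i j → (U *ᴹ conjugateTranspose U) [ i , j ] ≡ ⟨ lookup U i , lookup U j ⟩
  gram-entry U i j = trans (lookup-matrix (λ i j → sum λ k → U [ i , k ] * conjugateTranspose U [ k , j ]) i j)
    (sum-cong-≗ λ k → cong (U [ i , k ] *_) (lookup-matrix (λ i j → U [ j , i ] ^ q) k j))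

  GU⇒orthonormal : ∀ U → GU U → Orthonormal U
  GU⇒orthonormal U (_ , UU*) i j =
    trans (sym (gram-entry U i j)) (trans (cong (_[ i , j ]) UU*) (lookup-matrix δ i j))

  orthonormal⇒GU : ∀ U → GL U → Orthonormal U → GU U
  orthonormal⇒GU U gl on = gl , lookup-injective λ i → lookup-injective λ j →
    trans (gram-entry U i j) (trans (on i j) (sym (lookup-matrix δ i j)))

  form-invariant : ∀ U → GU U → ∀ x y → ⟨ x · U , y · U ⟩ ≡ ⟨ x , y ⟩
  form-invariant U u x y = begin
    ⟨ x · U , y · U ⟩                                  ≡⟨ form-·ˡ x U (y · U) ⟩
    sum (λ k → lookup x k * ⟨ lookup U k , y · U ⟩)    ≡⟨ sum-cong-≗ (λ k → cong (lookup x k *_) (row k)) ⟩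
    ⟨ x , y ⟩                                          ∎
    where
    row : ∀ k → ⟨ lookup U k , y · U ⟩ ≡ lookup y k ^ q
    row k = begin
      ⟨ lookup U k , y · U ⟩                                   ≡⟨ form-conj (y · U) (lookup U k) ⟩
      ⟨ y · U , lookup U k ⟩ ^ q                               ≡⟨ cong (_^ q) (form-·ˡ y U (lookup U k)) ⟩
      sum (λ l → lookup y l * ⟨ lookup U l , lookup U k ⟩) ^ q
        ≡⟨ cong (_^ q) (sum-cong-≗ λ l → cong (lookup y l *_) (GU⇒orthonormal U u l k)) ⟩
      sum (λ l → lookup y l * δ l k) ^ q                       ≡⟨ cong (_^ q) (sum-*δ (lookup y) k) ⟩
      lookup y k ^ q                                           ∎

  *ᵛ-· : ∀ c x U → (c *ᵛ x) · U ≡ c *ᵛ (x · U)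
  *ᵛ-· c x U = lookup-injective λ j → begin
    lookup ((c *ᵛ x) · U) j                     ≡⟨ lookup-· (c *ᵛ x) U j ⟩
    sum (λ k → lookup (c *ᵛ x) k * U [ k , j ])
      ≡⟨ sum-cong-≗ (λ k → trans (cong (_* U [ k , j ]) (lookup-*ᵛ c x k)) (*-assoc c _ _)) ⟩
    sum (λ k → c * (lookup x k * U [ k , j ]))  ≡⟨ *-distribˡ-sum c (λ k → lookup x k * U [ k , j ]) ⟨
    c * sum (λ k → lookup x k * U [ k , j ])    ≡⟨ cong (c *_) (lookup-· x U j) ⟨
    c * lookup (x · U) j                        ≡⟨ lookup-*ᵛ c (x · U) j ⟨
    lookup (c *ᵛ (x · U)) j                     ∎

  GU-identity : GU 1ᴹ
  GU-identity = orthonormal⇒GU 1ᴹ (1ᴹ , *ᴹ-identityʳ 1ᴹ , *ᴹ-identityʳ 1ᴹ) form-e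

  -- `U` sends the rows of its inverse to the standard basis, so invariance of the form under `U`
  -- makes those rows orthonormal.
  GU-inverse : ∀ U (u : GU U) → GU (proj₁ (proj₁ u))
  GU-inverse U u@((V , UV , VU) , _) = orthonormal⇒GU V (U , VU , UV) λ i j → begin
    ⟨ lookup V i , lookup V j ⟩              ≡⟨ form-invariant U u (lookup V i) (lookup V j) ⟨
    ⟨ lookup V i · U , lookup V j · U ⟩      ≡⟨ cong₂ ⟨_,_⟩ (row i) (row j) ⟩
    ⟨ e i , e j ⟩                            ≡⟨ form-e i j ⟩
    δ i j                                    ∎
    where
    row : ∀ i → lookup V i · U ≡ e i
    row i = trans (sym (row-*ᴹ V U i)) (cong (λ M → lookup M i) VU)

  GU-* : ∀ U V → GU U → GU V → GU (U *ᴹ V)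
  GU-* U V u@((U′ , UU′ , U′U) , _) v@((V′ , VV′ , V′V) , _) =
    orthonormal⇒GU (U *ᴹ V) (V′ *ᴹ U′ , cancel U U′ V V′ UU′ VV′ , cancel V′ V U′ U V′V U′U) λ i j → begin
      ⟨ lookup (U *ᴹ V) i , lookup (U *ᴹ V) j ⟩ ≡⟨ cong₂ ⟨_,_⟩ (row-*ᴹ U V i) (row-*ᴹ U V j) ⟩
      ⟨ lookup U i · V , lookup U j · V ⟩       ≡⟨ form-invariant V v (lookup U i) (lookup U j) ⟩
      ⟨ lookup U i , lookup U j ⟩               ≡⟨ GU⇒orthonormal U u i j ⟩
      δ i j                                     ∎
    where
    cancel : ∀ A A′ B B′ → A *ᴹ A′ ≡ 1ᴹ → B *ᴹ B′ ≡ 1ᴹ → A *ᴹ B *ᴹ (B′ *ᴹ A′) ≡ 1ᴹ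
    cancel A A′ B B′ AA′ BB′ = begin
      A *ᴹ B *ᴹ (B′ *ᴹ A′)   ≡⟨ *ᴹ-assoc (A *ᴹ B) B′ A′ ⟨
      A *ᴹ B *ᴹ B′ *ᴹ A′     ≡⟨ cong (_*ᴹ A′) (*ᴹ-assoc A B B′) ⟩
      A *ᴹ (B *ᴹ B′) *ᴹ A′   ≡⟨ cong (λ M → A *ᴹ M *ᴹ A′) BB′ ⟩
      A *ᴹ 1ᴹ *ᴹ A′          ≡⟨ cong (_*ᴹ A′) (*ᴹ-identityʳ A) ⟩
      A *ᴹ A′                ≡⟨ AA′ ⟩
      1ᴹ                     ∎

  ·-inverse : ∀ U (u : GU U) x → x · U · proj₁ (proj₁ u) ≡ x
  ·-inverse U ((V , UV , _) , _) x = trans (sym (·-assoc x U V)) (trans (cong (x ·_) UV) (·-identity x))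

  -- Pairs of vectors in one unitary orbit

  -- `R o` unfolds to this relation with the representatives of `o` as first pair, so membership in
  -- an orbital is handled by composing and inverting congruences.
  Congruent : (a b x y : Vector) → Set
  Congruent a b x y = ∃[ U ] (GU U × a · U ≡ x × b · U ≡ y)

  congruent-refl : ∀ {a b} → Congruent a b a b
  congruent-refl {a} {b} = 1ᴹ , GU-identity , ·-identity a , ·-identity b

  congruent-sym : ∀ {a b x y} → Congruent a b x y → Congruent x y a b
  congruent-sym {a} {b} (U , u , refl , refl) = proj₁ (proj₁ u) , GU-inverse U u , ·-inverse U u a , ·-inverse U u b

  congruent-trans : ∀ {a b c d x y} → Congruent a b c d → Congruent c d x y → Congruent a b x y
  congruent-trans {a} {b} (U , u , refl , refl) (V , v , refl , refl) =
    U *ᴹ V , GU-* U V u v , ·-assoc a U V , ·-assoc b U V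

  congruent-swap : ∀ {a b x y} → Congruent a b x y → Congruent b a y x
  congruent-swap (U , u , aU , bU) = U , u , bU , aU

  rows : (Vector → Vector) → Matrix
  rows f = tabulate (f ∘ e)

  Linear : (Vector → Vector) → Set
  Linear f = ∀ x → x · rows f ≡ f x

  -- Allows unitary matrices to be given as functions: `g` supplies the two-sided inverse demanded
  -- by `GL`, and the images of the standard basis are the orthonormal rows.
  isometry⇒congruent : ∀ f g → Linear f → Linear g → (∀ x → g (f x) ≡ x) → (∀ x → f (g x) ≡ x) →
                       (∀ x y → ⟨ f x , f y ⟩ ≡ ⟨ x , y ⟩) → ∀ x y → Congruent x y (f x) (f y)
  isometry⇒congruent f g f-lin g-lin gf fg iso x y =
    rows f , orthonormal⇒GU (rows f) (rows g , cancel f g g-lin gf , cancel g f f-lin fg) orthonormal , f-lin x , f-lin y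
    where
    cancel : ∀ f g → Linear g → (∀ x → g (f x) ≡ x) → rows f *ᴹ rows g ≡ 1ᴹ
    cancel f g g-lin gf = lookup-injective λ i → begin
      lookup (rows f *ᴹ rows g) i   ≡⟨ row-*ᴹ (rows f) (rows g) i ⟩
      lookup (rows f) i · rows g    ≡⟨ g-lin (lookup (rows f) i) ⟩
      g (lookup (rows f) i)         ≡⟨ cong g (Vec.lookup∘tabulate (f ∘ e) i) ⟩
      g (f (e i))                   ≡⟨ gf (e i) ⟩
      e i                           ∎
    orthonormal : Orthonormal (rows f)
    orthonormal i j = begin
      ⟨ lookup (rows f) i , lookup (rows f) j ⟩
        ≡⟨ cong₂ ⟨_,_⟩ (Vec.lookup∘tabulate (f ∘ e) i) (Vec.lookup∘tabulate (f ∘ e) j) ⟩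
      ⟨ f (e i) , f (e j) ⟩                     ≡⟨ iso (e i) (e j) ⟩
      ⟨ e i , e j ⟩                             ≡⟨ form-e i j ⟩
      δ i j                                     ∎

  lookup-rows : ∀ x f j → lookup (x · rows f) j ≡ sum λ k → lookup x k * lookup (f (e k)) j
  lookup-rows x f j =
    trans (lookup-· x (rows f) j) (sum-cong-≗ λ k → cong (λ r → lookup x k * lookup r j) (Vec.lookup∘tabulate (f ∘ e) k))

  -- Reflections, transvections and diagonal maps

  -- One family for two kinds of maps: for suitable `a`, a unitary transvection if `u` is isotropic
  -- and a unitary reflection otherwise.
  reflect : Vector → Carrier → Vector → Vector
  reflect u a x = x +ᵛ (a * ⟨ x , u ⟩) *ᵛ u

  lookup-reflect : ∀ u a x i → lookup (reflect u a x) i ≡ lookup x i + a * ⟨ x , u ⟩ * lookup u i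
  lookup-reflect u a x i = trans (lookup-+ᵛ x _ i) (cong (lookup x i +_) (lookup-*ᵛ (a * ⟨ x , u ⟩) u i))

  reflect-linear : ∀ u a → Linear (reflect u a)
  reflect-linear u a x = lookup-injective λ j → begin
    lookup (x · rows (reflect u a)) j
      ≡⟨ lookup-rows x (reflect u a) j ⟩
    sum (λ k → lookup x k * lookup (reflect u a (e k)) j)
      ≡⟨ sum-cong-≗ (λ k → trans (cong (lookup x k *_) (entry k j))
           (solve 5 (λ x d a u v → x :* (d :+ a :* u :* v) := x :* d :+ a :* v :* (x :* u)) refl
              (lookup x k) (δ k j) a (lookup u k ^ q) (lookup u j))) ⟩
    sum (λ k → lookup x k * δ k j + a * lookup u j * (lookup x k * lookup u k ^ q))
      ≡⟨ ∑-distrib-+ (λ k → lookup x k * δ k j) (λ k → a * lookup u j * (lookup x k * lookup u k ^ q)) ⟩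
    sum (λ k → lookup x k * δ k j) + sum (λ k → a * lookup u j * (lookup x k * lookup u k ^ q))
      ≡⟨ cong₂ _+_ (sum-*δ (lookup x) j) (sym (*-distribˡ-sum (a * lookup u j) (λ k → lookup x k * lookup u k ^ q))) ⟩
    lookup x j + a * lookup u j * ⟨ x , u ⟩
      ≡⟨ solve 4 (λ x a u f → x :+ a :* u :* f := x :+ a :* f :* u) refl (lookup x j) a (lookup u j) ⟨ x , u ⟩ ⟩
    lookup x j + a * ⟨ x , u ⟩ * lookup u j
      ≡⟨ lookup-reflect u a x j ⟨
    lookup (reflect u a x) j ∎
    where
    entry : ∀ k j → lookup (reflect u a (e k)) j ≡ δ k j + a * lookup u k ^ q * lookup u j
    entry k j =
      trans (lookup-reflect u a (e k) j) (cong₂ (λ d f → d + a * f * lookup u j) (lookup-e k j) (form-eˡ k u))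

  reflect-inverse : ∀ u a b → a + b + a * b * ⟨ u , u ⟩ ≡ 0# → ∀ x → reflect u b (reflect u a x) ≡ x
  reflect-inverse u a b eq x = lookup-injective λ i → begin
    lookup (reflect u b y) i                                   ≡⟨ lookup-reflect u b y i ⟩
    lookup y i + b * ⟨ y , u ⟩ * lookup u i
      ≡⟨ cong₂ (λ c f → c + b * f * lookup u i) (lookup-reflect u a x i)
                                                                    (trans (form-+ˡ x _ u) (cong (⟨ x , u ⟩ +_) (form-*ˡ _ u u))) ⟩
    (lookup x i + a * X * lookup u i) + b * (X + a * X * N) * lookup u i
      ≡⟨ solve 6 (λ x a b X N u → (x :+ a :* X :* u) :+ b :* (X :+ a :* X :* N) :* u := x :+ (a :+ b :+ a :* b :* N) :* X :* u) refl
           (lookup x i) a b X N (lookup u i) ⟩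
    lookup x i + (a + b + a * b * N) * X * lookup u i          ≡⟨ cong (λ z → lookup x i + z * X * lookup u i) eq ⟩
    lookup x i + 0# * X * lookup u i
      ≡⟨ solve 3 (λ x X u → x :+ con 0 :* X :* u := x) refl (lookup x i) X (lookup u i) ⟩
    lookup x i                                                 ∎
    where
    y = reflect u a x
    X = ⟨ x , u ⟩
    N = ⟨ u , u ⟩

  reflect-isometry : ∀ u a → a + a ^ q + a * a ^ q * ⟨ u , u ⟩ ≡ 0# → ∀ x y → ⟨ reflect u a x , reflect u a y ⟩ ≡ ⟨ x , y ⟩
  reflect-isometry u a eq x y = begin
    ⟨ x +ᵛ aX *ᵛ u , y′ ⟩
      ≡⟨ trans (form-+ˡ x (aX *ᵛ u) y′) (cong (⟨ x , y′ ⟩ +_) (form-*ˡ aX u y′)) ⟩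
    ⟨ x , y′ ⟩ + aX * ⟨ u , y′ ⟩                         ≡⟨ cong₂ (λ s t → s + aX * t) (expand x) (expand u) ⟩
    (⟨ x , y ⟩ + ā * Y * X) + aX * (⟨ u , y ⟩ + ā * Y * N)
      ≡⟨ cong (λ z → (⟨ x , y ⟩ + ā * Y * X) + aX * (z + ā * Y * N)) (form-conj y u) ⟩
    (⟨ x , y ⟩ + ā * Y * X) + aX * (Y + ā * Y * N)
      ≡⟨ solve 6 (λ f a b X Y N → (f :+ b :* Y :* X) :+ a :* X :* (Y :+ b :* Y :* N) := f :+ (a :+ b :+ a :* b :* N) :* X :* Y) refl
                                                              ⟨ x , y ⟩ a ā X Y N ⟩
    ⟨ x , y ⟩ + (a + ā + a * ā * N) * X * Y              ≡⟨ cong (λ z → ⟨ x , y ⟩ + z * X * Y) eq ⟩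
    ⟨ x , y ⟩ + 0# * X * Y
      ≡⟨ solve 3 (λ f X Y → f :+ con 0 :* X :* Y := f) refl ⟨ x , y ⟩ X Y ⟩
    ⟨ x , y ⟩                                            ∎
    where
    ā = a ^ q
    X = ⟨ x , u ⟩
    Y = ⟨ y , u ⟩ ^ q
    N = ⟨ u , u ⟩
    aX = a * X
    y′ = reflect u a y
    expand : ∀ z → ⟨ z , y′ ⟩ ≡ ⟨ z , y ⟩ + ā * Y * ⟨ z , u ⟩
    expand z = begin
      ⟨ z , y +ᵛ (a * ⟨ y , u ⟩) *ᵛ u ⟩             ≡⟨ form-+ʳ y _ z ⟩
      ⟨ z , y ⟩ + ⟨ z , (a * ⟨ y , u ⟩) *ᵛ u ⟩      ≡⟨ cong (⟨ z , y ⟩ +_) (form-*ʳ _ u z) ⟩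
      ⟨ z , y ⟩ + (a * ⟨ y , u ⟩) ^ q * ⟨ z , u ⟩
        ≡⟨ cong (λ c → ⟨ z , y ⟩ + c * ⟨ z , u ⟩) (^-distrib-* a ⟨ y , u ⟩ q) ⟩
      ⟨ z , y ⟩ + ā * Y * ⟨ z , u ⟩                 ∎

  -- For `b = a ^ q` the condition of `reflect-inverse` is the very condition that preserves the
  -- form, so the inverse has the conjugate coefficient.
  reflect-congruent : ∀ u a → a + a ^ q + a * a ^ q * ⟨ u , u ⟩ ≡ 0# → ∀ x y → Congruent x y (reflect u a x) (reflect u a y)
  reflect-congruent u a eq = isometry⇒congruent (reflect u a) (reflect u ā) (reflect-linear u a) (reflect-linear u ā)
    (reflect-inverse u a ā eq) (reflect-inverse u ā a (trans (solve 3 (λ a b N → b :+ a :+ b :* a :* N := a :+ b :+ a :* b :* N) refl a ā ⟨ u , u ⟩) eq))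
    (reflect-isometry u a eq)
    where ā = a ^ q

  dilate : Vector → Vector → Vector
  dilate d x = zipWith _*_ x d

  dilate-linear : ∀ d → Linear (dilate d)
  dilate-linear d x = lookup-injective λ j → begin
    lookup (x · rows (dilate d)) j                        ≡⟨ lookup-rows x (dilate d) j ⟩
    sum (λ k → lookup x k * lookup (dilate d (e k)) j)
      ≡⟨ sum-cong-≗ (λ k → cong (lookup x k *_) (trans (Vec.lookup-zipWith _*_ j (e k) d) (cong (_* lookup d j) (lookup-e k j)))) ⟩
    sum (λ k → lookup x k * (δ k j * lookup d j))
      ≡⟨ sum-cong-≗ (λ k → sym (*-assoc (lookup x k) (δ k j) (lookup d j))) ⟩
    sum (λ k → lookup x k * δ k j * lookup d j)           ≡⟨ *-distribʳ-sum (lookup d j) (λ k → lookup x k * δ k j) ⟨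
    sum (λ k → lookup x k * δ k j) * lookup d j           ≡⟨ cong (_* lookup d j) (sum-*δ (lookup x) j) ⟩
    lookup x j * lookup d j                               ≡⟨ Vec.lookup-zipWith _*_ j x d ⟨
    lookup (dilate d x) j                                 ∎

  dilate-congruent : ∀ d → (∀ i → lookup d i * lookup d i ^ q ≡ 1#) → ∀ x y → Congruent x y (dilate d x) (dilate d y)
  dilate-congruent d norm = isometry⇒congruent (dilate d) (dilate (conj d)) (dilate-linear d) (dilate-linear (conj d))
    (inverse-to d (conj d) λ i → trans (cong (lookup d i *_) (lookup-conj d i)) (norm i))
    (inverse-to (conj d) d λ i → trans (cong (_* lookup d i) (lookup-conj d i)) (trans (*-comm _ _) (norm i)))
    isometry
    where
    inverse-to : ∀ c d → (∀ i → lookup c i * lookup d i ≡ 1#) → ∀ x → dilate d (dilate c x) ≡ x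
    inverse-to c d cd x = lookup-injective λ i → begin
      lookup (dilate d (dilate c x)) i          ≡⟨ Vec.lookup-zipWith _*_ i (dilate c x) d ⟩
      lookup (dilate c x) i * lookup d i        ≡⟨ cong (_* lookup d i) (Vec.lookup-zipWith _*_ i x c) ⟩
      lookup x i * lookup c i * lookup d i      ≡⟨ *-assoc _ _ _ ⟩
      lookup x i * (lookup c i * lookup d i)    ≡⟨ cong (lookup x i *_) (cd i) ⟩
      lookup x i * 1#                           ≡⟨ *-identityʳ _ ⟩
      lookup x i                                ∎
    isometry : ∀ x y → ⟨ dilate d x , dilate d y ⟩ ≡ ⟨ x , y ⟩
    isometry x y = sum-cong-≗ λ i → begin
      lookup (dilate d x) i * lookup (dilate d y) i ^ q
        ≡⟨ cong₂ (λ a b → a * b ^ q) (Vec.lookup-zipWith _*_ i x d) (Vec.lookup-zipWith _*_ i y d) ⟩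
      lookup x i * lookup d i * (lookup y i * lookup d i) ^ q
        ≡⟨ cong (lookup x i * lookup d i *_) (^-distrib-* (lookup y i) (lookup d i) q) ⟩
      lookup x i * lookup d i * (lookup y i ^ q * lookup d i ^ q)
        ≡⟨ solve 4 (λ x d y b → x :* d :* (y :* b) := x :* y :* (d :* b)) refl (lookup x i) (lookup d i) (lookup y i ^ q) (lookup d i ^ q) ⟩
      lookup x i * lookup y i ^ q * (lookup d i * lookup d i ^ q)
        ≡⟨ trans (cong (lookup x i * lookup y i ^ q *_) (norm i)) (*-identityʳ _) ⟩
      lookup x i * lookup y i ^ q ∎

-- Witnesses from equal cardinalities, and arithmetic of q

module _ {A : Set} (E : Enumeration A) {P Q : Pred A 0ℓ} (P? : Decidable P) (Q? : Decidable Q) where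
  open Enumeration E

  -- All that the case `q > 2` extracts from equal intersection numbers: if one is positive, so is
  -- the other.
  card-≡-witness : card P? ≡ card Q? → ∃[ x ] P x → ∃[ y ] Q y
  card-≡-witness eq (x , px) with filter P? elements | ∈-filter⁺ P? (complete x) px | filter Q? elements in eqQ
  ... | _ ∷ _ | _ | y ∷ _ = y , proj₂ (∈-filter⁻ Q? {xs = elements} (subst (y ∈_) (sym eqQ) (here refl)))
  card-≡-witness () _ | _ ∷ _ | _ | []

even⊎odd : ∀ k → (∃[ r ] k ≡ r ℕ.+ r) ⊎ (∃[ r ] k ≡ suc (r ℕ.+ r))
even⊎odd zero    = inj₁ (0 , refl)
even⊎odd (suc k) with even⊎odd k
... | inj₁ (r , eq) = inj₂ (r , cong suc eq)
... | inj₂ (r , eq) = inj₁ (suc r , cong suc (trans eq (sym (ℕ.+-suc r r))))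

[r+r]²≡2*[r*[r+r]] : ∀ r → (r ℕ.+ r) ℕ.^ 2 ≡ 2 ℕ.* (r ℕ.* (r ℕ.+ r))
[r+r]²≡2*[r*[r+r]] = solve 1 (λ r → (r :+ r) :* ((r :+ r) :* con 1) := con 2 :* (r :* (r :+ r))) refl
  where open +-*-Solver

[1+r+r]²≡1+2*[r*[2+r+r]] : ∀ r → suc (r ℕ.+ r) ℕ.^ 2 ≡ suc (r ℕ.* suc (suc (r ℕ.+ r)) ℕ.+ r ℕ.* suc (suc (r ℕ.+ r)))
[1+r+r]²≡1+2*[r*[2+r+r]] = solve 1 (λ r → let q = con 1 :+ (r :+ r) in
  q :* (q :* con 1) := con 1 :+ (r :* (con 1 :+ q) :+ r :* (con 1 :+ q))) refl
  where open +-*-Solver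

[1+r]²≡1+r*[2+r] : ∀ r → suc r ℕ.^ 2 ≡ suc (r ℕ.* suc (suc r))
[1+r]²≡1+r*[2+r] = solve 1 (λ r → (con 1 :+ r) :* ((con 1 :+ r) :* con 1) := con 1 :+ r :* (con 2 :+ r)) refl
  where open +-*-Solver

-- Makes room for the root count of `X ^ (2 + q) - X`. At `q = 2` both sides equal 4, as they must:
-- every element of 𝔽₄ is a root.
2+q<q² : ∀ {q} → 3 ≤ q → 2 ℕ.+ q < q ℕ.^ 2
2+q<q² {q} 3≤q = begin-strict
  2 ℕ.+ q          <⟨ ℕ.+-monoˡ-< q (ℕ.<-≤-trans (s≤s (s≤s (s≤s z≤n))) (ℕ.*-monoʳ-≤ 2 3≤q)) ⟩
  2 ℕ.* q ℕ.+ q    ≡⟨ ℕ.+-comm (2 ℕ.* q) q ⟩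
  3 ℕ.* q          ≤⟨ ℕ.*-monoˡ-≤ q 3≤q ⟩
  q ℕ.* q          ≡⟨ cong (q ℕ.*_) (ℕ.*-identityʳ q) ⟨
  q ℕ.^ 2          ∎
  where open ℕ.≤-Reasoning

primePower⇒2≤ : ∀ {q} → PrimePower q → 2 ≤ q
primePower⇒2≤ (p , suc k , pr , _ , refl) = ℕ.≤-trans (ℕ.nonTrivial⇒n>1 p) (ℕ.m≤m*n p (p ℕ.^ k))
  where instance
    _ = prime⇒nonTrivial pr
    _ = ℕ.m^n≢0 p k {{prime⇒nonZero pr}}

-- Norms in the quadratic extension

module QuadraticExtension {q : ℕ} (q-primePower : PrimePower q) (F : FiniteField (q ℕ.^ 2)) where
  open FiniteField F
  open FiniteFieldProperties F
  open CommutativeRing commutativeRing using (semiring; commutativeSemiring; ring; *-identityˡ; *-identityʳ; -‿inverseʳ; zeroˡ)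
  open Exp semiring using (^-homo-*; ^-assocʳ)
  open RingProperties ring using (-‿distribˡ-*; -‿involutive)
  open SemiringSolver commutativeSemiring using (solve; _:=_; _:+_; _:*_; con)
  open ≡-Reasoning

  2≤q : 2 ≤ q
  2≤q = primePower⇒2≤ q-primePower

  0<q : 0 < q
  0<q = ℕ.<-trans (s≤s z≤n) 2≤q

  0<q² : 0 < q ℕ.^ 2
  0<q² = ℕ.m^n>0 q {{ℕ.>-nonZero 0<q}} 2

  conj-+ : ∀ x y → (x + y) ^ q ≡ x ^ q + y ^ q
  conj-+ = let p , k , pr , _ , q≡p^k = q-primePower in
    subst (λ r → ∀ x y → (x + y) ^ r ≡ x ^ r + y ^ r) (sym q≡p^k) (frobenius-^-+ pr (p•1≡0 p (k ℕ.* 2) (trans (cong (ℕ._^ 2) q≡p^k) (ℕ.^-*-assoc p k 2))) k)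

  conj-conj : ∀ x → (x ^ q) ^ q ≡ x
  conj-conj x = begin
    (x ^ q) ^ q   ≡⟨ ^-assocʳ x q q ⟩
    x ^ (q ℕ.* q) ≡⟨ cong (λ r → x ^ (q ℕ.* r)) (ℕ.*-identityʳ q) ⟨
    x ^ (q ℕ.^ 2) ≡⟨ fermat x 0<q² ⟩
    x             ∎

  ^[q²-1] : ∀ {t k} → t ≢ 0# → suc k ≡ q ℕ.^ 2 → t ^ k ≡ 1#
  ^[q²-1] {t} {k} t≢0 eq = *-cancelˡ t t≢0 $ begin
    t ^ suc k      ≡⟨ cong (t ^_) eq ⟩
    t ^ (q ℕ.^ 2)  ≡⟨ fermat t 0<q² ⟩
    t              ≡⟨ *-identityʳ t ⟨
    t * 1#         ∎

  ^≢⇒nonzero : ∀ {t} k → t ^ suc k ≢ t → t ≢ 0#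
  ^≢⇒nonzero k ≢t refl = ≢t (zeroˡ _)

  ^≢⇒^≢1 : ∀ {t} k → t ^ suc k ≢ t → t ^ k ≢ 1#
  ^≢⇒^≢1 {t} k ≢t ≡1 = ≢t (trans (cong (t *_) ≡1) (*-identityʳ t))

  x²≡1⇒x≡-1 : ∀ {x} → x * x ≡ 1# → x ≢ 1# → 1# + x ≡ 0#
  x²≡1⇒x≡-1 {x} x²≡1 x≢1 with 1# + x ≟ 0#
  ... | yes eq = eq
  ... | no  ≢0 = contradiction (*-cancelˡ (1# + x) ≢0 (begin
    (1# + x) * x     ≡⟨ solve 1 (λ x → (con 1 :+ x) :* x := x :+ x :* x) refl x ⟩
    x + x * x        ≡⟨ cong (x +_) x²≡1 ⟩
    x + 1#           ≡⟨ solve 1 (λ x → x :+ con 1 := (con 1 :+ x) :* con 1) refl x ⟩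
    (1# + x) * 1#    ∎)) x≢1

  -- Gives the isotropic vector `(1 , α)`. For even `q`, Fermat makes `- 1#` equal to its own even
  -- power, which is 1, so `α = 1#` works. For `q = 2r + 1` the number `h = r (q + 1)` is half of
  -- `q ^ 2 - 1`; if `t` is nonzero and `t ^ h` is not 1 then it is -1, and it is the norm of
  -- `t ^ r`.
  -1-norm : ∃[ α ] 1# + α * α ^ q ≡ 0#
  -1-norm with even⊎odd q
  ... | inj₁ (r , q≡r+r) = 1# , (begin
    1# + 1# * 1# ^ q     ≡⟨ cong (1# +_) (trans (*-identityˡ _) (1^ q)) ⟩
    1# + 1#              ≡⟨ cong (1# +_) (begin
      1#                       ≡⟨ 1^ (r ℕ.* q) ⟨
      1# ^ (r ℕ.* q)           ≡⟨ cong (_^ (r ℕ.* q)) -1*-1≡1 ⟨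
      ((- 1#) ^ 2) ^ (r ℕ.* q) ≡⟨ ^-assocʳ (- 1#) 2 (r ℕ.* q) ⟩
      (- 1#) ^ (2 ℕ.* (r ℕ.* q)) ≡⟨ cong ((- 1#) ^_) 2rq≡q² ⟩
      (- 1#) ^ (q ℕ.^ 2)       ≡⟨ fermat (- 1#) 0<q² ⟩
      - 1#                     ∎) ⟩
    1# + - 1#            ≡⟨ -‿inverseʳ 1# ⟩
    0#                   ∎)
    where
    -1*-1≡1 : (- 1#) ^ 2 ≡ 1#
    -1*-1≡1 = begin
      - 1# * (- 1# * 1#)   ≡⟨ cong (- 1# *_) (*-identityʳ (- 1#)) ⟩
      - 1# * - 1#          ≡⟨ -‿distribˡ-* 1# (- 1#) ⟨
      - (1# * - 1#)        ≡⟨ cong -_ (*-identityˡ (- 1#)) ⟩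
      - - 1#               ≡⟨ -‿involutive 1# ⟩
      1#                   ∎
    2rq≡q² : 2 ℕ.* (r ℕ.* q) ≡ q ℕ.^ 2
    2rq≡q² = subst (λ q → 2 ℕ.* (r ℕ.* q) ≡ q ℕ.^ 2) (sym q≡r+r) (sym ([r+r]²≡2*[r*[r+r]] r))
  ... | inj₂ (r , q≡1+2r) = t ^ r , (begin
    1# + t ^ r * (t ^ r) ^ q    ≡⟨ cong (1# +_) (^-assocʳ t r (suc q)) ⟩
    1# + t ^ h
      ≡⟨ x²≡1⇒x≡-1 (trans (sym (^-homo-* t h h)) (^[q²-1] (^≢⇒nonzero h t^≢t) 1+2h≡q²)) (^≢⇒^≢1 h t^≢t) ⟩
    0#                          ∎)
    where
    h = r ℕ.* suc q
    1+2h≡q² : suc (h ℕ.+ h) ≡ q ℕ.^ 2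
    1+2h≡q² = subst (λ q → suc (r ℕ.* suc q ℕ.+ r ℕ.* suc q) ≡ q ℕ.^ 2) (sym q≡1+2r)
      (sym ([1+r+r]²≡1+2*[r*[2+r+r]] r))
    0<r : 0 < r
    0<r = ℕ.n≢0⇒n>0 λ r≡0 → ℕ.>⇒≢ 2≤q (trans q≡1+2r (cong (λ r → suc (r ℕ.+ r)) r≡0))
    0<h : 0 < h
    0<h = ℕ.≤-trans 0<r (ℕ.m≤m*n r (suc q))
    witness = ∃-^≢ (suc h) (s≤s 0<h) (subst (suc h <_) 1+2h≡q² (s≤s (ℕ.m<m+n h 0<h)))
    t = proj₁ witness
    t^≢t = proj₂ witness

  -- As in Hilbert 90: for nonzero `t` the quotient of `t ^ q` by `t` has norm
  -- `t ^ (q ^ 2 - 1) = 1`, and it is 1 only if `t` is fixed by conjugation.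
  nontrivial-norm1 : ∃[ μ ] (μ ≢ 1# × μ * μ ^ q ≡ 1#)
  nontrivial-norm1 = t ^ q′ , ^≢⇒^≢1 q′ t^≢t , (begin
    t ^ q′ * (t ^ q′) ^ q   ≡⟨ ^-assocʳ t q′ (suc q) ⟩
    t ^ (q′ ℕ.* suc q)
      ≡⟨ ^[q²-1] (^≢⇒nonzero q′ t^≢t) (subst (λ q → suc (q′ ℕ.* suc q) ≡ q ℕ.^ 2) 1+q′≡q (sym ([1+r]²≡1+r*[2+r] q′))) ⟩
    1#                      ∎)
    where
    q′ = ℕ.pred q
    1+q′≡q : suc q′ ≡ q
    1+q′≡q = ℕ.suc-pred q {{ℕ.>-nonZero 0<q}}
    q<q² : q < q ℕ.^ 2
    q<q² = subst (q <_) (cong (q ℕ.*_) (sym (ℕ.*-identityʳ q))) (ℕ.m<m*n q q {{ℕ.>-nonZero 0<q}} 2≤q)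
    witness = ∃-^≢ (suc q′) (subst (2 ≤_) (sym 1+q′≡q) 2≤q) (subst (_< q ℕ.^ 2) (sym 1+q′≡q) q<q²)
    t = proj₁ witness
    t^≢t = proj₂ witness

  -- The norm of `t` is `t ^ (1 + q)`, so a `t` that is not a root of `X ^ (2 + q) - X` has both
  -- properties.
  non-norm1 : 3 ≤ q → ∃[ c ] (c ≢ 0# × c * c ^ q ≢ 1#)
  non-norm1 3≤q = t , ^≢⇒nonzero (suc q) t^≢t , ^≢⇒^≢1 (suc q) t^≢t
    where
    witness = ∃-^≢ (suc (suc q)) (s≤s (s≤s z≤n)) (2+q<q² 3≤q)
    t = proj₁ witness
    t^≢t = proj₂ witness

-- Non-commutativity for q > 2

module Noncommutativity (n q : ℕ) (q-primePower : PrimePower q) (F : FiniteField (q ℕ.^ 2)) where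
  open FiniteField F
  open FiniteFieldProperties F
  open QuadraticExtension q-primePower F
  open UnitaryScheme (suc (suc n)) q F
  open UnitaryGeometry (suc (suc n)) q F 0<q conj-+ conj-conj
  open CommutativeRing commutativeRing using (semiring; commutativeSemiring; ring; +-identityʳ; *-assoc; *-identityˡ; *-identityʳ; zeroˡ; zeroʳ)
  open CommutativeExp commutativeSemiring using (^-distrib-*)
  open RingProperties ring using (+-cancelˡ)
  open Sum semiring using (sum-cong-≗; sum-replicate-zero)
  open SemiringSolver commutativeSemiring using (solve; _:=_; _:*_)
  open ≡-Reasoning

  pair : Carrier → Carrier → Vector
  pair a b = a ∷ b ∷ Vec.replicate n 0#

  form-pair : ∀ a b c d → ⟨ pair a b , pair c d ⟩ ≡ a * c ^ q + b * d ^ q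
  form-pair a b c d =
    cong (a * c ^ q +_) (trans (cong (b * d ^ q +_) (trans (sum-cong-≗ zeros) (sum-replicate-zero n))) (+-identityʳ _))
    where
    zeros : ∀ (i : Fin n) → lookup (Vec.replicate n 0#) i * lookup (Vec.replicate n 0#) i ^ q ≡ 0#
    zeros i = trans (cong (_* lookup (Vec.replicate n 0#) i ^ q) (Vec.lookup-replicate i 0#)) (zeroˡ _)

  pair-Φ : ∀ {b} → 1# + b * b ^ q ≡ 0# → Φ (pair 1# b)
  pair-Φ {b} eq = (λ ≡0 → 0≢1 (sym (cong (λ v → lookup v zero) ≡0))) ,
    trans (form-pair 1# b 1# b) (trans (cong (_+ b * b ^ q) (trans (*-identityˡ _) (1^ q))) eq)

  *ᵛ-Φ : ∀ {c x} → c ≢ 0# → Φ x → Φ (c *ᵛ x)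
  *ᵛ-Φ {c} {x} c≢0 (x≢0 , xx≡0) = (λ ≡0 → x≢0 (lookup-injective (coordinate ≡0))) , (begin
    ⟨ c *ᵛ x , c *ᵛ x ⟩     ≡⟨ form-*ˡ c x (c *ᵛ x) ⟩
    c * ⟨ x , c *ᵛ x ⟩      ≡⟨ cong (c *_) (form-*ʳ c x x) ⟩
    c * (c ^ q * ⟨ x , x ⟩) ≡⟨ cong (λ z → c * (c ^ q * z)) xx≡0 ⟩
    c * (c ^ q * 0#)        ≡⟨ trans (cong (c *_) (zeroʳ _)) (zeroʳ c) ⟩
    0#                      ∎)
    where
    coordinate : c *ᵛ x ≡ 0ᵛ → ∀ i → lookup x i ≡ lookup 0ᵛ i
    coordinate ≡0 i = trans (x*y≡0⇒y≡0 c≢0 (begin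
      c * lookup x i       ≡⟨ lookup-*ᵛ c x i ⟨
      lookup (c *ᵛ x) i    ≡⟨ cong (λ v → lookup v i) ≡0 ⟩
      lookup 0ᵛ i          ≡⟨ Vec.lookup-replicate i 0# ⟩
      0#                   ∎)) (sym (Vec.lookup-replicate i 0#))

  -- Multiplying `α` by the norm-one `μ` keeps the vector isotropic, and the product of the two
  -- vectors becomes `1 - μ ^ q`. It could vanish only for `μ = 1`, since `μ * μ ^ q` is 1.
  hyperbolic-pair : ∃[ x ] ∃[ y ] (Φ x × Φ y × ⟨ x , y ⟩ ≢ 0#)
  hyperbolic-pair = pair 1# α , pair 1# (α * μ) , pair-Φ α-norm , pair-Φ αμ-norm , xy≢0
    where
    α = proj₁ -1-norm
    α-norm = proj₂ -1-norm
    μ = proj₁ nontrivial-norm1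
    μ≢1 = proj₁ (proj₂ nontrivial-norm1)
    μ-norm = proj₂ (proj₂ nontrivial-norm1)
    αμ-norm : 1# + (α * μ) * (α * μ) ^ q ≡ 0#
    αμ-norm = begin
      1# + (α * μ) * (α * μ) ^ q           ≡⟨ cong (λ z → 1# + (α * μ) * z) (^-distrib-* α μ q) ⟩
      1# + (α * μ) * (α ^ q * μ ^ q)
        ≡⟨ cong (1# +_) (solve 4 (λ a m b n → a :* m :* (b :* n) := a :* b :* (m :* n)) refl α μ (α ^ q) (μ ^ q)) ⟩
      1# + (α * α ^ q) * (μ * μ ^ q)       ≡⟨ cong (λ z → 1# + (α * α ^ q) * z) μ-norm ⟩
      1# + (α * α ^ q) * 1#                ≡⟨ cong (1# +_) (*-identityʳ _) ⟩
      1# + α * α ^ q                       ≡⟨ α-norm ⟩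
      0#                                   ∎
    form≡ : ⟨ pair 1# α , pair 1# (α * μ) ⟩ ≡ 1# + (α * α ^ q) * μ ^ q
    form≡ = begin
      ⟨ pair 1# α , pair 1# (α * μ) ⟩    ≡⟨ form-pair 1# α 1# (α * μ) ⟩
      1# * 1# ^ q + α * (α * μ) ^ q
        ≡⟨ cong₂ (λ a b → a + α * b) (trans (*-identityˡ _) (1^ q)) (^-distrib-* α μ q) ⟩
      1# + α * (α ^ q * μ ^ q)           ≡⟨ cong (1# +_) (*-assoc α _ _) ⟨
      1# + (α * α ^ q) * μ ^ q           ∎
    αα̅≢0 : α * α ^ q ≢ 0#
    αα̅≢0 ≡0 = 0≢1 (trans (sym α-norm) (trans (cong (1# +_) ≡0) (+-identityʳ 1#)))
    xy≢0 : ⟨ pair 1# α , pair 1# (α * μ) ⟩ ≢ 0#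
    xy≢0 ≡0 = μ≢1 $ begin
      μ            ≡⟨ *-identityʳ μ ⟨
      μ * 1#       ≡⟨ cong (μ *_) μ^q≡1 ⟨
      μ * μ ^ q    ≡⟨ μ-norm ⟩
      1#           ∎
      where
      μ^q≡1 : μ ^ q ≡ 1#
      μ^q≡1 = *-cancelˡ (α * α ^ q) αα̅≢0 $ +-cancelˡ 1# _ _ $ begin
        1# + (α * α ^ q) * μ ^ q   ≡⟨ trans (sym form≡) ≡0 ⟩
        0#                         ≡⟨ α-norm ⟨
        1# + α * α ^ q             ≡⟨ cong (1# +_) (*-identityʳ _) ⟨
        1# + (α * α ^ q) * 1#      ∎

  intersection-witness : ∀ i j k l x y → intersectionNumber i j x y ≡ intersectionNumber k l x y →
                         ∃[ z ] (Φ z × R i x z × R j z y) → ∃[ z ] (Φ z × R k x z × R l z y)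
  intersection-witness i j k l x y = card-≡-witness vectors
    (λ z → Φ? z ×-dec R? i x z ×-dec R? j z y) (λ z → Φ? z ×-dec R? k x z ×-dec R? l z y)

  -- The second step of the reversed path, being congruent to `(x , c x)`, forces `y = c z`; the
  -- first gives `⟨ c x , y ⟩ = ⟨ x , z ⟩`. Combined, they return `⟨ x , y ⟩` multiplied by the norm
  -- of `c`.
  norm≡1 : ∀ {x y} c (x∈Φ : Φ x) (y∈Φ : Φ y) (cx∈Φ : Φ (c *ᵛ x)) → ⟨ x , y ⟩ ≢ 0# →
           ∃[ z ] (Φ z × R (orbital cx∈Φ y∈Φ) x z × R (orbital x∈Φ cx∈Φ) z y) → c * c ^ q ≡ 1#
  norm≡1 {x} {y} c _ _ _ xy≢0 (z , _ , (U , u , cxU≡x , yU≡z) , (V , _ , xV≡z , cxV≡y)) =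
    *-cancelˡ ⟨ x , y ⟩ xy≢0 $ begin
    ⟨ x , y ⟩ * (c * c ^ q)          ≡⟨ solve 3 (λ f c b → f :* (c :* b) := b :* (c :* f)) refl ⟨ x , y ⟩ c (c ^ q) ⟩
    c ^ q * (c * ⟨ x , y ⟩)          ≡⟨ cong (c ^ q *_) (form-*ˡ c x y) ⟨
    c ^ q * ⟨ c *ᵛ x , y ⟩           ≡⟨ cong (c ^ q *_) (form-invariant U u (c *ᵛ x) y) ⟨
    c ^ q * ⟨ (c *ᵛ x) · U , y · U ⟩ ≡⟨ cong₂ (λ a b → c ^ q * ⟨ a , b ⟩) cxU≡x yU≡z ⟩
    c ^ q * ⟨ x , z ⟩                ≡⟨ form-*ʳ c z x ⟨
    ⟨ x , c *ᵛ z ⟩                   ≡⟨ cong (λ v → ⟨ x , c *ᵛ v ⟩) xV≡z ⟨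
    ⟨ x , c *ᵛ (x · V) ⟩             ≡⟨ cong (λ v → ⟨ x , v ⟩) (trans (sym (*ᵛ-· c x V)) cxV≡y) ⟩
    ⟨ x , y ⟩                        ≡⟨ *-identityʳ _ ⟨
    ⟨ x , y ⟩ * 1#                   ∎

  ¬commutative : 3 ≤ q → ¬ Commutative
  ¬commutative 3≤q comm =
    let x , y , x∈Φ , y∈Φ , xy≢0 = hyperbolic-pair
        c , c≢0 , norm≢1         = non-norm1 3≤q
        cx∈Φ = *ᵛ-Φ {c} {x} c≢0 x∈Φ
        h = orbital x∈Φ y∈Φ
        i = orbital x∈Φ cx∈Φ
        j = orbital cx∈Φ y∈Φ
    in norm≢1 $ norm≡1 c x∈Φ y∈Φ cx∈Φ xy≢0 $
       intersection-witness i j j i x y (comm h i j x y congruent-refl)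
         -- In the order `i`, `j` the midpoint is `c *ᵛ x` itself.
         (c *ᵛ x , cx∈Φ , congruent-refl , congruent-refl)

-- Comparing cardinalities along an injection

unique-⊆⇒length≤ : ∀ {A : Set} {xs ys : List A} → Unique xs → (∀ {x} → x ∈ xs → x ∈ ys) → length xs ≤ length ys
unique-⊆⇒length≤ {xs = []} _ _ = z≤n
unique-⊆⇒length≤ {xs = x ∷ xs} {ys} (x∉xs AllPairs.∷ uniq) ⊆ys with as , bs , refl ← ∈-∃++ (⊆ys (here refl)) =
  subst (suc (length xs) ≤_) (sym (length-++-sucʳ as x bs)) (s≤s (unique-⊆⇒length≤ uniq drop))
  where
  drop : ∀ {z} → z ∈ xs → z ∈ as ++ bs
  drop z∈xs with ∈-++⁻ as (⊆ys (there z∈xs))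
  ... | inj₁ z∈as         = ∈-++⁺ˡ z∈as
  ... | inj₂ (there z∈bs) = ∈-++⁺ʳ as z∈bs
  ... | inj₂ (here refl)  = contradiction refl (All.lookup x∉xs z∈xs)

card-≤ : ∀ {A : Set} (E : Enumeration A) {P Q : Pred A 0ℓ} (P? : Decidable P) (Q? : Decidable Q) (f : A → A) →
         (∀ {x y} → f x ≡ f y → x ≡ y) → (∀ x → P x → Q (f x)) → Enumeration.card E P? ≤ Enumeration.card E Q?
card-≤ E P? Q? f f-injective P⇒Q = subst (_≤ length (filter Q? elements)) (length-map f (filter P? elements))
  (unique-⊆⇒length≤ (Unique.map⁺ f-injective (Unique.filter⁺ P? unique)) image)
  where
  open Enumeration E
  image : ∀ {y} → y ∈ map f (filter P? elements) → y ∈ filter Q? elements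
  image y∈ with x , x∈ , refl ← ∈-map⁻ f y∈ = ∈-filter⁺ Q? (complete (f x)) (P⇒Q x (proj₂ (∈-filter⁻ P? {xs = elements} x∈)))

-- The case q = 2: arithmetic of the field with four elements

module Quaternary (n q : ℕ) (q-primePower : PrimePower q) (F : FiniteField (q ℕ.^ 2)) (q≡2 : q ≡ 2) where
  open FiniteField F
  open FiniteFieldProperties F
  open QuadraticExtension q-primePower F
  open UnitaryScheme n q F
  open UnitaryGeometry n q F 0<q conj-+ conj-conj
  open CommutativeRing commutativeRing using (semiring; commutativeSemiring; ring; +-identityˡ; +-identityʳ; *-assoc; *-comm; *-identityˡ; *-identityʳ; -‿inverseʳ; zeroˡ; zeroʳ)
  open CommutativeExp commutativeSemiring using (^-distrib-*)
  open RingProperties ring using (+-cancelˡ; -0#≈0#)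
  open Sum semiring using (sum-cong-≗; sum-replicate-zero; ∑-distrib-+)
  open ≡-Reasoning

  conj≡square : ∀ x → x ^ q ≡ x * x
  conj≡square x = trans (cong (x ^_) q≡2) (cong (x *_) (*-identityʳ x))

  1+1≡0 : 1# + 1# ≡ 0#
  1+1≡0 = trans (cong (1# +_) (sym (+-identityʳ 1#))) (p•1≡0 2 2 (cong (ℕ._^ 2) q≡2))

  -- A ring solver with coefficients in 𝔽₂, so that it knows the characteristic.
  private
    ⟦_⟧₂ : Bool → Carrier
    ⟦ true  ⟧₂ = 1#
    ⟦ false ⟧₂ = 0#

    𝔽₂⟶F : CommutativeRing.rawRing xor-∧-commutativeRing -Raw-AlmostCommutative⟶ fromCommutativeRing commutativeRing
    𝔽₂⟶F = record
      { ⟦_⟧    = ⟦_⟧₂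
      ; +-homo = λ { true true → sym 1+1≡0 ; true false → sym (+-identityʳ 1#) ; false b → sym (+-identityˡ ⟦ b ⟧₂) }
      ; *-homo = λ { true b → sym (*-identityˡ ⟦ b ⟧₂) ; false b → sym (zeroˡ ⟦ b ⟧₂) }
      ; -‿homo = λ { true → +-cancelˡ 1# _ _ (trans 1+1≡0 (sym (-‿inverseʳ 1#))) ; false → sym -0#≈0# }
      ; 0-homo = refl
      ; 1-homo = refl
      }

    _≟₂_ : ∀ a b → Maybe (⟦ a ⟧₂ ≡ ⟦ b ⟧₂)
    true  ≟₂ true  = just refl
    false ≟₂ false = just refl
    _     ≟₂ _     = nothing

  open RingSolver (CommutativeRing.rawRing xor-∧-commutativeRing) (fromCommutativeRing commutativeRing) 𝔽₂⟶F _≟₂_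
    using (solve; _:=_; _:+_; _:*_; con)

  x+x≡0 : ∀ x → x + x ≡ 0#
  x+x≡0 = solve 1 (λ x → x :+ x := con false) refl

  x+y≡0⇒x≡y : ∀ {x y} → x + y ≡ 0# → x ≡ y
  x+y≡0⇒x≡y {x} {y} eq =
    trans (solve 2 (λ x y → x := (x :+ y) :+ y) refl x y) (trans (cong (_+ y) eq) (+-identityˡ y))

  -- For `q = 2` the exponent `q + 1` of the norm is `q ^ 2 - 1`, the order of the multiplicative
  -- group.
  norm≡1 : ∀ {x} → x ≢ 0# → x * x ^ q ≡ 1#
  norm≡1 {x} x≢0 = ^[q²-1] {k = suc q} x≢0 (subst (λ r → suc (suc r) ≡ r ℕ.^ 2) (sym q≡2) refl)

  0^q : 0# ^ q ≡ 0#
  0^q = 0^ 0<q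

  conj-fixed : ∀ {x} → x ^ q ≡ x → x ≢ 0# → x ≡ 1#
  conj-fixed {x} fixed x≢0 = *-cancelˡ x x≢0 (trans (sym (conj≡square x)) (trans fixed (sym (*-identityʳ x))))

  -- Trace and norm 1, that is, the roots of `X ^ 2 + X + 1`. Such an `a` satisfies the condition of
  -- `reflect-isometry` when `⟨ u , u ⟩ ≡ 1#`.
  CubeRoot : Carrier → Set
  CubeRoot a = a + a ^ q ≡ 1# × a * a ^ q ≡ 1#

  primitiveCubeRoot : ∃[ a ] CubeRoot a
  primitiveCubeRoot = let μ , μ≢1 , μ-norm = nontrivial-norm1 in
    μ , *-cancelˡ (1# + μ) (λ 1+μ≡0 → μ≢1 (sym (x+y≡0⇒x≡y 1+μ≡0))) (begin
      (1# + μ) * (μ + μ ^ q)     ≡⟨ cong (λ z → (1# + μ) * (μ + z)) (conj≡square μ) ⟩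
      (1# + μ) * (μ + μ * μ)     ≡⟨ solve 1 (λ m → (con true :+ m) :* (m :+ m :* m) := m :* (m :* m) :+ m) refl μ ⟩
      μ * (μ * μ) + μ            ≡⟨ cong (λ z → μ * z + μ) (conj≡square μ) ⟨
      μ * μ ^ q + μ              ≡⟨ cong (_+ μ) μ-norm ⟩
      1# + μ                     ≡⟨ *-identityʳ (1# + μ) ⟨
      (1# + μ) * 1#              ∎) , μ-norm

  CubeRoot-1+ : ∀ {a} → CubeRoot a → CubeRoot (1# + a)
  CubeRoot-1+ {a} (a+ā≡1 , aā≡1) = (begin
      (1# + a) + (1# + a) ^ q    ≡⟨ cong ((1# + a) +_) conj[1+a] ⟩
      (1# + a) + (1# + a ^ q)    ≡⟨ solve 2 (λ a b → (con true :+ a) :+ (con true :+ b) := a :+ b) refl a (a ^ q) ⟩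
      a + a ^ q                  ≡⟨ a+ā≡1 ⟩
      1#                         ∎) , (begin
      (1# + a) * (1# + a) ^ q    ≡⟨ cong ((1# + a) *_) conj[1+a] ⟩
      (1# + a) * (1# + a ^ q)
        ≡⟨ solve 2 (λ a b → (con true :+ a) :* (con true :+ b) := con true :+ (a :+ b) :+ a :* b) refl a (a ^ q) ⟩
      1# + (a + a ^ q) + a * a ^ q ≡⟨ cong₂ (λ s t → 1# + s + t) a+ā≡1 aā≡1 ⟩
      1# + 1# + 1#               ≡⟨ solve 0 (con true :+ con true :+ con true := con true) refl ⟩
      1#                         ∎)
    where
    conj[1+a] : (1# + a) ^ q ≡ 1# + a ^ q
    conj[1+a] = trans (conj-+ 1# a) (cong (_+ a ^ q) (1^ q))

  -- With `a` also `1# + a` is such a root; the two values of `f + a * e` differ by `e`, so they do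
  -- not both vanish.
  cubeRoot-avoiding : ∀ {e} f → e ≢ 0# → ∃[ a ] (CubeRoot a × f + a * e ≢ 0#)
  cubeRoot-avoiding {e} f e≢0 = choose primitiveCubeRoot
    where
    choose : ∃[ a ] CubeRoot a → ∃[ a ] (CubeRoot a × f + a * e ≢ 0#)
    choose (a , root) with f + a * e ≟ 0#
    ... | no  ≢0 = a , root , ≢0
    ... | yes ≡0 = 1# + a , CubeRoot-1+ root , λ ≡0′ → e≢0 (begin
      e
        ≡⟨ solve 3 (λ e f a → e := (f :+ a :* e) :+ (f :+ (con true :+ a) :* e)) refl e f a ⟩
      (f + a * e) + (f + (1# + a) * e)    ≡⟨ cong₂ _+_ ≡0 ≡0′ ⟩
      0# + 0#                             ≡⟨ +-identityʳ 0# ⟩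
      0#                                  ∎)

  -- The diagonal map and its error term, coordinate by coordinate

  -- offset a b is the entry of {a , b} that is nonzero, if there is exactly one.
  offset : Carrier → Carrier → Carrier
  offset a b with a ≟ 0# | b ≟ 0#
  ... | yes _ | yes _ = 0#
  ... | no  _ | yes _ = a
  ... | yes _ | no  _ = b
  ... | no  _ | no  _ = 0#

  -- If both entries are nonzero, `a * b` takes `a ^ q` to `b` and `b ^ q` to `a`, because norms are
  -- 1. If only one is nonzero, exchanging it with 0 is impossible; its conjugate is sent back to it
  -- instead, and `offset` records the difference.
  dilation : Carrier → Carrier → Carrier
  dilation a b with a ≟ 0# | b ≟ 0#
  ... | yes _ | yes _ = 1#
  ... | no  _ | yes _ = a ^ q
  ... | yes _ | no  _ = b ^ q
  ... | no  _ | no  _ = a * b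

  dilation-norm : ∀ a b → dilation a b * dilation a b ^ q ≡ 1#
  dilation-norm a b with a ≟ 0# | b ≟ 0#
  ... | yes _   | yes _   = norm≡1 (0≢1 ∘ sym)
  ... | no  a≢0 | yes _   = norm≡1 (^-nonzero q a≢0)
  ... | yes _   | no  b≢0 = norm≡1 (^-nonzero q b≢0)
  ... | no  a≢0 | no  b≢0 = norm≡1 (*-nonzero a≢0 b≢0)

  conj*conj : ∀ a → a ^ q * a ^ q ≡ a
  conj*conj a = trans (sym (conj≡square (a ^ q))) (conj-conj a)

  dilation-conjˡ : ∀ a b → a ^ q * dilation a b ≡ b + offset a b
  dilation-conjˡ a b with a ≟ 0# | b ≟ 0#
  ... | yes refl | yes refl = trans (*-identityʳ _) (trans 0^q (sym (+-identityʳ 0#)))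
  ... | no  a≢0  | yes refl = trans (conj*conj a) (sym (+-identityˡ a))
  ... | yes refl | no  b≢0  = trans (cong (_* b ^ q) 0^q) (trans (zeroˡ _) (sym (x+x≡0 b)))
  ... | no  a≢0  | no  b≢0  = begin
    a ^ q * (a * b)   ≡⟨ solve 3 (λ c a b → c :* (a :* b) := a :* c :* b) refl (a ^ q) a b ⟩
    a * a ^ q * b     ≡⟨ cong (_* b) (norm≡1 a≢0) ⟩
    1# * b            ≡⟨ trans (*-identityˡ b) (sym (+-identityʳ b)) ⟩
    b + 0#            ∎

  dilation-conjʳ : ∀ a b → b ^ q * dilation a b ≡ a + offset a b
  dilation-conjʳ a b with a ≟ 0# | b ≟ 0#
  ... | yes refl | yes refl = trans (*-identityʳ _) (trans 0^q (sym (+-identityʳ 0#)))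
  ... | no  a≢0  | yes refl = trans (cong (_* a ^ q) 0^q) (trans (zeroˡ _) (sym (x+x≡0 a)))
  ... | yes refl | no  b≢0  = trans (conj*conj b) (sym (+-identityˡ b))
  ... | no  a≢0  | no  b≢0  = begin
    b ^ q * (a * b)   ≡⟨ solve 3 (λ c a b → c :* (a :* b) := b :* c :* a) refl (b ^ q) a b ⟩
    b * b ^ q * a     ≡⟨ cong (_* a) (norm≡1 b≢0) ⟩
    1# * a            ≡⟨ trans (*-identityˡ a) (sym (+-identityʳ a)) ⟩
    a + 0#            ∎

  -- Where both entries are nonzero their norms cancel. Summed over the coordinates, this makes `u`
  -- isotropic.
  offset-norm : ∀ a b → offset a b * offset a b ^ q ≡ a * a ^ q + b * b ^ q
  offset-norm a b with a ≟ 0# | b ≟ 0#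
  ... | yes refl | yes refl = trans (zeroˡ _) (sym (x+x≡0 _))
  ... | no  a≢0  | yes refl = sym (trans (cong (a * a ^ q +_) (zeroˡ _)) (+-identityʳ _))
  ... | yes refl | no  b≢0  = sym (trans (cong (_+ b * b ^ q) (zeroˡ _)) (+-identityˡ _))
  ... | no  a≢0  | no  b≢0  = trans (zeroˡ _) (sym (trans (cong₂ _+_ (norm≡1 a≢0) (norm≡1 b≢0)) 1+1≡0))

  -- Summed over the coordinates, this gives `⟨ x , u ⟩ = ⟨ y , u ⟩`, so one transvection along `u`
  -- treats both vectors alike.
  offset-+ : ∀ a b → a * offset a b ^ q + b * offset a b ^ q ≡ a * a ^ q + b * b ^ q
  offset-+ a b with a ≟ 0# | b ≟ 0#
  ... | yes refl | yes refl = refl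
  ... | no  a≢0  | yes refl = cong (a * a ^ q +_) (trans (zeroˡ _) (sym (zeroˡ _)))
  ... | yes refl | no  b≢0  = cong (_+ b * b ^ q) (trans (zeroˡ _) (sym (zeroˡ _)))
  ... | no  a≢0  | no  b≢0  =
    trans (cong₂ _+_ (vanish a) (vanish b)) (trans (+-identityʳ 0#) (sym (trans (cong₂ _+_ (norm≡1 a≢0) (norm≡1 b≢0)) 1+1≡0)))
    where
    vanish : ∀ c → c * 0# ^ q ≡ 0#
    vanish c = trans (cong (c *_) 0^q) (zeroʳ c)

  -- The product is a norm or 0. Summed over the coordinates, `⟨ x , u ⟩` is fixed by conjugation.
  offset-conj-fixed : ∀ a b → (a * offset a b ^ q) ^ q ≡ a * offset a b ^ q
  offset-conj-fixed a b with a ≟ 0# | b ≟ 0#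
  ... | yes refl | yes refl = trans (cong (_^ q) (zeroˡ _)) (trans 0^q (sym (zeroˡ _)))
  ... | no  a≢0  | yes refl = trans (cong (_^ q) (norm≡1 a≢0)) (trans (1^ q) (sym (norm≡1 a≢0)))
  ... | yes refl | no  b≢0  = trans (cong (_^ q) (zeroˡ _)) (trans 0^q (sym (zeroˡ _)))
  ... | no  a≢0  | no  b≢0  = trans (cong (_^ q) vanish) (trans 0^q (sym vanish))
    where
    vanish : a * 0# ^ q ≡ 0#
    vanish = trans (cong (a *_) 0^q) (zeroʳ a)

  offset-left : ∀ {a b} → a ≢ 0# → b ≡ 0# → offset a b ≡ a
  offset-left {a} {b} a≢0 b≡0 with a ≟ 0# | b ≟ 0#
  ... | yes a≡0 | _       = contradiction a≡0 a≢0
  ... | no  _   | yes _   = refl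
  ... | no  _   | no  b≢0 = contradiction b≡0 b≢0

  offset-right : ∀ {a b} → a ≡ 0# → b ≢ 0# → offset a b ≡ b
  offset-right {a} {b} a≡0 b≢0 with a ≟ 0# | b ≟ 0#
  ... | no a≢0 | _       = contradiction a≡0 a≢0
  ... | yes _  | yes b≡0 = contradiction b≡0 b≢0
  ... | yes _  | no  _   = refl

  offset-none : ∀ {a b} → ¬ (a ≢ 0# × b ≡ 0#) → ¬ (a ≡ 0# × b ≢ 0#) → offset a b ≡ 0#
  offset-none {a} {b} ¬left ¬right with a ≟ 0# | b ≟ 0#
  ... | yes _   | yes _   = refl
  ... | no  a≢0 | yes b≡0 = contradiction (a≢0 , b≡0) ¬left
  ... | yes a≡0 | no  b≢0 = contradiction (a≡0 , b≢0) ¬right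
  ... | no  _   | no  _   = refl

  -- Translations by transvections

  -- Splits the translation by `u` into translations by `v` and by `u +ᵛ v`, for use when no
  -- transvection along `u` achieves it.
  +ᵛ-cancel : ∀ x u v → x +ᵛ v +ᵛ (u +ᵛ v) ≡ x +ᵛ u
  +ᵛ-cancel x u v = lookup-injective λ i → begin
    lookup (x +ᵛ v +ᵛ (u +ᵛ v)) i
      ≡⟨ trans (lookup-+ᵛ (x +ᵛ v) (u +ᵛ v) i) (cong₂ _+_ (lookup-+ᵛ x v i) (lookup-+ᵛ u v i)) ⟩
    (lookup x i + lookup v i) + (lookup u i + lookup v i)
      ≡⟨ solve 3 (λ x v u → (x :+ v) :+ (u :+ v) := x :+ u) refl (lookup x i) (lookup v i) (lookup u i) ⟩
    lookup x i + lookup u i                                 ≡⟨ lookup-+ᵛ x u i ⟨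
    lookup (x +ᵛ u) i                                       ∎

  transvection : ∀ s t u → ⟨ u , u ⟩ ≡ 0# → ⟨ s , u ⟩ ≡ 1# → ⟨ t , u ⟩ ≡ 1# → Congruent s t (s +ᵛ u) (t +ᵛ u)
  transvection s t u uu≡0 su≡1 tu≡1 =
    subst₂ (Congruent s t) (translate s su≡1) (translate t tu≡1) (reflect-congruent u 1# cond s t)
    where
    cond : 1# + 1# ^ q + 1# * 1# ^ q * ⟨ u , u ⟩ ≡ 0#
    cond = begin
      1# + 1# ^ q + 1# * 1# ^ q * ⟨ u , u ⟩  ≡⟨ cong₂ (λ c d → 1# + c + 1# * c * d) (1^ q) uu≡0 ⟩
      1# + 1# + 1# * 1# * 0#
        ≡⟨ solve 0 (con true :+ con true :+ con true :* con true :* con false := con false) refl ⟩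
      0#                                     ∎
    translate : ∀ s → ⟨ s , u ⟩ ≡ 1# → reflect u 1# s ≡ s +ᵛ u
    translate s su≡1 = lookup-injective λ i → begin
      lookup (reflect u 1# s) i                        ≡⟨ lookup-reflect u 1# s i ⟩
      lookup s i + 1# * ⟨ s , u ⟩ * lookup u i         ≡⟨ cong (λ c → lookup s i + 1# * c * lookup u i) su≡1 ⟩
      lookup s i + 1# * 1# * lookup u i
        ≡⟨ solve 2 (λ s u → s :+ con true :* con true :* u := s :+ u) refl (lookup s i) (lookup u i) ⟩
      lookup s i + lookup u i                          ≡⟨ lookup-+ᵛ s u i ⟨
      lookup (s +ᵛ u) i                                ∎

  form-*eʳ : ∀ x c i → ⟨ x , c *ᵛ e i ⟩ ≡ c ^ q * lookup x i
  form-*eʳ x c i = trans (form-*ʳ c (e i) x) (cong (c ^ q *_) (form-eʳ i x))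

  lookup-*e-refl : ∀ c i → lookup (c *ᵛ e i) i ≡ c
  lookup-*e-refl c i =
    trans (lookup-*ᵛ c (e i) i) (trans (cong (c *_) (trans (lookup-e i i) (δ-refl i))) (*-identityʳ c))

  lookup-*e-distinct : ∀ c {i j} → i ≢ j → lookup (c *ᵛ e i) j ≡ 0#
  lookup-*e-distinct c {i} {j} i≢j =
    trans (lookup-*ᵛ c (e i) j) (trans (cong (c *_) (trans (lookup-e i j) (δ-distinct i≢j))) (zeroʳ c))

  conj-norm≡1 : ∀ {x} → x ≢ 0# → x ^ q * x ≡ 1#
  conj-norm≡1 x≢0 = trans (*-comm _ _) (norm≡1 x≢0)

  -- Swapping a pair, according to the supports

  module _ (x y : Vector) (xx≡0 : ⟨ x , x ⟩ ≡ 0#) (yy≡0 : ⟨ y , y ⟩ ≡ 0#) where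

    private
      u d : Vector
      u = tabulate λ i → offset (lookup x i) (lookup y i)
      d = tabulate λ i → dilation (lookup x i) (lookup y i)

      lookup-u : ∀ i → lookup u i ≡ offset (lookup x i) (lookup y i)
      lookup-u = Vec.lookup∘tabulate _

      lookup-d : ∀ i → lookup d i ≡ dilation (lookup x i) (lookup y i)
      lookup-d = Vec.lookup∘tabulate _

    sum-norms : sum (λ i → lookup x i * lookup x i ^ q + lookup y i * lookup y i ^ q) ≡ 0#
    sum-norms =
      trans (∑-distrib-+ (λ i → lookup x i * lookup x i ^ q) (λ i → lookup y i * lookup y i ^ q)) (trans (cong₂ _+_ xx≡0 yy≡0) (+-identityʳ 0#))

    private
      uu≡0 : ⟨ u , u ⟩ ≡ 0#
      uu≡0 =
        trans (sum-cong-≗ λ i → trans (cong (λ c → c * c ^ q) (lookup-u i)) (offset-norm (lookup x i) (lookup y i))) sum-norms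

      xu≡yu : ⟨ x , u ⟩ ≡ ⟨ y , u ⟩
      xu≡yu = x+y≡0⇒x≡y $ begin
        ⟨ x , u ⟩ + ⟨ y , u ⟩ ≡⟨ ∑-distrib-+ (λ i → lookup x i * lookup u i ^ q) (λ i → lookup y i * lookup u i ^ q) ⟨
        sum (λ i → lookup x i * lookup u i ^ q + lookup y i * lookup u i ^ q)
          ≡⟨ sum-cong-≗ (λ i → trans (cong (λ c → lookup x i * c ^ q + lookup y i * c ^ q) (lookup-u i)) (offset-+ (lookup x i) (lookup y i))) ⟩
        sum (λ i → lookup x i * lookup x i ^ q + lookup y i * lookup y i ^ q) ≡⟨ sum-norms ⟩
        0# ∎

      xu-fixed : ⟨ x , u ⟩ ^ q ≡ ⟨ x , u ⟩
      xu-fixed = trans (conj-sum (λ i → lookup x i * lookup u i ^ q)) $ sum-cong-≗ λ i →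
        subst (λ c → (lookup x i * c ^ q) ^ q ≡ lookup x i * c ^ q) (sym (lookup-u i)) (offset-conj-fixed (lookup x i) (lookup y i))

    -- A diagonal matrix takes the conjugates of x and y to y + u and x + u, where u collects the
    -- coordinates at which exactly one of x and y vanishes.
    swap-from-offset : Congruent y x (y +ᵛ u) (x +ᵛ u) → Congruent (conj x) (conj y) y x
    swap-from-offset c = congruent-trans {conj x} {conj y} {y +ᵛ u} {x +ᵛ u} {y} {x}
      (subst₂ (Congruent (conj x) (conj y)) (image x y (λ i → dilation-conjˡ (lookup x i) (lookup y i))) (image y x (λ i → dilation-conjʳ (lookup x i) (lookup y i)))
        (dilate-congruent d (λ i → subst (λ c → c * c ^ q ≡ 1#) (sym (lookup-d i)) (dilation-norm (lookup x i) (lookup y i))) (conj x) (conj y)))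
      (congruent-sym {y} {x} {y +ᵛ u} {x +ᵛ u} c)
      where
      image : ∀ v w → (∀ i → lookup v i ^ q * dilation (lookup x i) (lookup y i) ≡ lookup w i + offset (lookup x i) (lookup y i)) → dilate d (conj v) ≡ w +ᵛ u
      image v w eq = lookup-injective λ i → begin
        lookup (dilate d (conj v)) i                                      ≡⟨ Vec.lookup-zipWith _*_ i (conj v) d ⟩
        lookup (conj v) i * lookup d i
          ≡⟨ cong₂ _*_ (lookup-conj v i) (lookup-d i) ⟩
        lookup v i ^ q * dilation (lookup x i) (lookup y i)               ≡⟨ eq i ⟩
        lookup w i + offset (lookup x i) (lookup y i)                     ≡⟨ cong (lookup w i +_) (lookup-u i) ⟨
        lookup w i + lookup u i                                           ≡⟨ lookup-+ᵛ w u i ⟨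
        lookup (w +ᵛ u) i                                                 ∎

    swap-equal-support : (∀ i → ¬ (lookup x i ≢ 0# × lookup y i ≡ 0#)) → (∀ i → ¬ (lookup x i ≡ 0# × lookup y i ≢ 0#)) →
                         Congruent (conj x) (conj y) y x
    swap-equal-support ¬left ¬right =
      swap-from-offset (subst₂ (Congruent y x) (unchanged y) (unchanged x) congruent-refl)
      where
      unchanged : ∀ v → v ≡ v +ᵛ u
      unchanged v = lookup-injective λ i → sym $ trans (lookup-+ᵛ v u i) $
        trans (cong (lookup v i +_) (trans (lookup-u i) (offset-none (¬left i) (¬right i)))) (+-identityʳ _)

    swap-incomparable-support : ∀ {p r} → lookup x p ≢ 0# → lookup y p ≡ 0# → lookup x r ≡ 0# → lookup y r ≢ 0# →
                                Congruent (conj x) (conj y) y x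
    swap-incomparable-support {p} {r} xp≢0 yp≡0 xr≡0 yr≢0 with ⟨ x , u ⟩ ≟ 0#
    ... | no  xu≢0 = swap-from-offset (transvection y x u uu≡0 (trans (sym xu≡yu) xu≡1) xu≡1)
      where xu≡1 = conj-fixed xu-fixed xu≢0
    ... | yes xu≡0 = swap-from-offset (subst₂ (Congruent y x) (+ᵛ-cancel y u v) (+ᵛ-cancel x u v)
      (congruent-trans {y} {x} {y +ᵛ v} {x +ᵛ v} {y +ᵛ v +ᵛ w} {x +ᵛ v +ᵛ w} (transvection y x v vv≡0 yv≡1 xv≡1) (transvection (y +ᵛ v) (x +ᵛ v) w ww≡0 (sw≡1 y yu≡0 yv≡1) (sw≡1 x xu≡0 xv≡1))))
      where
      -- `v` agrees with `u` at `p` and `r` and is zero elsewhere, so `⟨ v , v ⟩` and `⟨ u , v ⟩`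
      -- are both `1# + 1#`. Each of `x` and `y` meets just one of the two coordinates, which makes
      -- its product with `v` equal to 1. Hence `w` is isotropic too and has product 1 with both
      -- translated vectors.
      v w : Vector
      v = lookup x p *ᵛ e p +ᵛ lookup y r *ᵛ e r
      w = u +ᵛ v
      p≢r : p ≢ r
      p≢r refl = xp≢0 xr≡0
      yu≡0 = trans (sym xu≡yu) xu≡0
      form-v : ∀ z → ⟨ z , v ⟩ ≡ lookup x p ^ q * lookup z p + lookup y r ^ q * lookup z r
      form-v z =
        trans (form-+ʳ (lookup x p *ᵛ e p) (lookup y r *ᵛ e r) z) (cong₂ _+_ (form-*eʳ z (lookup x p) p) (form-*eʳ z (lookup y r) r))
      vanishing : ∀ z → lookup z p ≡ lookup x p → lookup z r ≡ lookup y r → ⟨ z , v ⟩ ≡ 0#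
      vanishing z zp zr = begin
        ⟨ z , v ⟩                                                     ≡⟨ form-v z ⟩
        lookup x p ^ q * lookup z p + lookup y r ^ q * lookup z r
          ≡⟨ cong₂ (λ a b → lookup x p ^ q * a + lookup y r ^ q * b) zp zr ⟩
        lookup x p ^ q * lookup x p + lookup y r ^ q * lookup y r
          ≡⟨ cong₂ _+_ (conj-norm≡1 xp≢0) (conj-norm≡1 yr≢0) ⟩
        1# + 1#                                                       ≡⟨ 1+1≡0 ⟩
        0#                                                            ∎
      vv≡0 : ⟨ v , v ⟩ ≡ 0#
      vv≡0 = vanishing v
        (trans (lookup-+ᵛ (lookup x p *ᵛ e p) (lookup y r *ᵛ e r) p) (trans (cong₂ _+_ (lookup-*e-refl (lookup x p) p) (lookup-*e-distinct (lookup y r) (p≢r ∘ sym))) (+-identityʳ _)))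
        (trans (lookup-+ᵛ (lookup x p *ᵛ e p) (lookup y r *ᵛ e r) r) (trans (cong₂ _+_ (lookup-*e-distinct (lookup x p) p≢r) (lookup-*e-refl (lookup y r) r)) (+-identityˡ _)))
      uv≡0 : ⟨ u , v ⟩ ≡ 0#
      uv≡0 = vanishing u (trans (lookup-u p) (offset-left xp≢0 yp≡0)) (trans (lookup-u r) (offset-right xr≡0 yr≢0))
      vu≡0 : ⟨ v , u ⟩ ≡ 0#
      vu≡0 = trans (form-conj u v) (trans (cong (_^ q) uv≡0) 0^q)
      xv≡1 : ⟨ x , v ⟩ ≡ 1#
      xv≡1 =
        trans (form-v x) (trans (cong₂ _+_ (conj-norm≡1 xp≢0) (trans (cong (lookup y r ^ q *_) xr≡0) (zeroʳ _))) (+-identityʳ 1#))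
      yv≡1 : ⟨ y , v ⟩ ≡ 1#
      yv≡1 =
        trans (form-v y) (trans (cong₂ _+_ (trans (cong (lookup x p ^ q *_) yp≡0) (zeroʳ _)) (conj-norm≡1 yr≢0)) (+-identityˡ 1#))
      expand : ∀ s t → ⟨ s +ᵛ t , w ⟩ ≡ (⟨ s , u ⟩ + ⟨ s , v ⟩) + (⟨ t , u ⟩ + ⟨ t , v ⟩)
      expand s t = trans (form-+ˡ s t w) (cong₂ _+_ (form-+ʳ u v s) (form-+ʳ u v t))
      ww≡0 : ⟨ w , w ⟩ ≡ 0#
      ww≡0 = trans (expand u v) (trans (cong₂ _+_ (cong₂ _+_ uu≡0 uv≡0) (cong₂ _+_ vu≡0 vv≡0))
        (solve 0 ((con false :+ con false) :+ (con false :+ con false) := con false) refl))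
      sw≡1 : ∀ s → ⟨ s , u ⟩ ≡ 0# → ⟨ s , v ⟩ ≡ 1# → ⟨ s +ᵛ v , w ⟩ ≡ 1#
      sw≡1 s su≡0 sv≡1 = trans (expand s v) (trans (cong₂ _+_ (cong₂ _+_ su≡0 sv≡1) (cong₂ _+_ vu≡0 vv≡0))
        (solve 0 ((con false :+ con true) :+ (con false :+ con false) := con true) refl))

  nonzero-coordinate : ∀ {x} → x ≢ 0ᵛ → ∃[ i ] lookup x i ≢ 0#
  nonzero-coordinate {x} x≢0 with Fin.any? (λ i → ¬? (lookup x i ≟ 0#))
  ... | yes found = found
  ... | no  none  =
    contradiction (lookup-injective λ i → trans (decidable-stable (lookup x i ≟ 0#) (λ ≢0 → none (i , ≢0))) (sym (Vec.lookup-replicate i 0#))) x≢0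

  -- A parity argument in disguise: applied to sums of norms, it turns one coordinate of a support
  -- into two.
  another-nonzero : ∀ {k} (f : Fin k → Carrier) → sum f ≡ 0# → ∀ i → f i ≢ 0# → ∃[ j ] (j ≢ i × f j ≢ 0#)
  another-nonzero f ∑≡0 i fi≢0 with Fin.any? (λ j → ¬? (j Fin.≟ i) ×-dec ¬? (f j ≟ 0#))
  ... | yes found = found
  ... | no  none  =
    contradiction (trans (sym (sum-support f i λ j j≢i → decidable-stable (f j ≟ 0#) (λ ≢0 → none (j , j≢i , ≢0)))) ∑≡0) fi≢0

  norm-nonzero : ∀ {x} → x ≢ 0# → x * x ^ q ≢ 0#
  norm-nonzero x≢0 = *-nonzero x≢0 (^-nonzero q x≢0)

  norm-nonzero⁻¹ : ∀ {x} → x * x ^ q ≢ 0# → x ≢ 0#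
  norm-nonzero⁻¹ ≢0 refl = ≢0 (zeroˡ _)

  -- Replacing `y` by its reflection in a swap also replaces `conj y` on the other side; the
  -- conjugate reflection does that.
  conj-reflect : ∀ u a x → conj (reflect u a x) ≡ reflect (conj u) (a ^ q) (conj x)
  conj-reflect u a x = lookup-injective λ i → begin
    lookup (conj (reflect u a x)) i                              ≡⟨ lookup-conj (reflect u a x) i ⟩
    lookup (reflect u a x) i ^ q                                 ≡⟨ cong (_^ q) (lookup-reflect u a x i) ⟩
    (lookup x i + a * ⟨ x , u ⟩ * lookup u i) ^ q                ≡⟨ conj-+ _ _ ⟩
    lookup x i ^ q + (a * ⟨ x , u ⟩ * lookup u i) ^ q
      ≡⟨ cong (lookup x i ^ q +_) (trans (^-distrib-* (a * ⟨ x , u ⟩) (lookup u i) q) (cong (_* lookup u i ^ q) (^-distrib-* a ⟨ x , u ⟩ q))) ⟩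
    lookup x i ^ q + a ^ q * ⟨ x , u ⟩ ^ q * lookup u i ^ q
      ≡⟨ cong (λ c → lookup x i ^ q + a ^ q * c * lookup u i ^ q) (trans (sym (form-conj x u)) (sym (form-conjugates x u))) ⟩
    lookup x i ^ q + a ^ q * ⟨ conj x , conj u ⟩ * lookup u i ^ q
      ≡⟨ cong₂ (λ s t → s + a ^ q * ⟨ conj x , conj u ⟩ * t) (lookup-conj x i) (lookup-conj u i) ⟨
    lookup (conj x) i + a ^ q * ⟨ conj x , conj u ⟩ * lookup (conj u) i
      ≡⟨ lookup-reflect (conj u) (a ^ q) (conj x) i ⟨
    lookup (reflect (conj u) (a ^ q) (conj x)) i                 ∎

  reflect-fixed : ∀ u a x → ⟨ x , u ⟩ ≡ 0# → reflect u a x ≡ x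
  reflect-fixed u a x xu≡0 = lookup-injective λ i → begin
    lookup (reflect u a x) i                         ≡⟨ lookup-reflect u a x i ⟩
    lookup x i + a * ⟨ x , u ⟩ * lookup u i          ≡⟨ cong (λ c → lookup x i + a * c * lookup u i) xu≡0 ⟩
    lookup x i + a * 0# * lookup u i
      ≡⟨ solve 3 (λ x a u → x :+ a :* con false :* u := x) refl (lookup x i) a (lookup u i) ⟩
    lookup x i                                       ∎

  -- If the support of x lies strictly inside that of y, a reflection fixing x moves y to a vector
  -- vanishing at a coordinate i of the support of x, but still not at a coordinate l outside it.
  swap-smaller-support : ∀ x y → ⟨ x , x ⟩ ≡ 0# → ⟨ y , y ⟩ ≡ 0# → x ≢ 0ᵛ → (∀ i → ¬ (lookup x i ≢ 0# × lookup y i ≡ 0#)) →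
                         ∀ k → lookup x k ≡ 0# → lookup y k ≢ 0# → Congruent (conj x) (conj y) y x
  swap-smaller-support x y xx≡0 yy≡0 x≢0 ¬left k xk≡0 yk≢0 =
    congruent-trans {conj x} {conj y} {conj x} {conj y′} {y} {x} conj-y~conj-y′
      (congruent-trans {conj x} {conj y′} {y′} {x} {y} {x}
        (swap-incomparable-support x y′ xx≡0 y′y′≡0 xi≢0 y′i≡0 xl≡0 y′l≢0)
        (congruent-sym {y} {x} {y′} {x} (congruent-swap {x} {y} {x} {y′} y~y′)))
    where
    found-i = nonzero-coordinate x≢0
    i = proj₁ found-i
    xi≢0 : lookup x i ≢ 0#
    xi≢0 = proj₂ found-i
    found-j = another-nonzero (λ i → lookup x i * lookup x i ^ q) xx≡0 i (norm-nonzero xi≢0)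
    j = proj₁ found-j
    j≢i : j ≢ i
    j≢i = proj₁ (proj₂ found-j)
    xj≢0 : lookup x j ≢ 0#
    xj≢0 = norm-nonzero⁻¹ (proj₂ (proj₂ found-j))
    -- At coordinates where both vectors are nonzero the norms add up to 0, so a second nonzero term
    -- lies, like `k`, in the support of `y` but outside that of `x`.
    found-l =
      another-nonzero (λ i → lookup x i * lookup x i ^ q + lookup y i * lookup y i ^ q) (sum-norms x y xx≡0 yy≡0) k
      λ ≡0 → norm-nonzero yk≢0 (trans (sym (trans (cong (λ c → c * c ^ q + lookup y k * lookup y k ^ q) xk≡0) (trans (cong (_+ lookup y k * lookup y k ^ q) (zeroˡ _)) (+-identityˡ _)))) ≡0)
    l = proj₁ found-l
    l≢k : l ≢ k
    l≢k = proj₁ (proj₂ found-l)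
    support : ∀ {i} → lookup x i ≢ 0# → lookup y i ≢ 0#
    support {i} xi≢0 yi≡0 = ¬left i (xi≢0 , yi≡0)
    xl≡0 : lookup x l ≡ 0#
    xl≡0 =
      decidable-stable (lookup x l ≟ 0#) λ xl≢0 → proj₂ (proj₂ found-l) (trans (cong₂ _+_ (norm≡1 xl≢0) (norm≡1 (support xl≢0))) 1+1≡0)
    yl≢0 : lookup y l ≢ 0#
    yl≢0 yl≡0 = proj₂ (proj₂ found-l) (trans (cong₂ (λ a b → a * a ^ q + b * b ^ q) xl≡0 yl≡0) (x+x≡0 _))
    -- `y′` vanishes at `i` once the coefficient `a * ⟨ y , u ⟩` of `u` equals `ε`, since `u` agrees
    -- with `x` at `i`.
    ε f : Carrier
    ε = lookup x i ^ q * lookup y i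
    f = lookup x j ^ q * lookup y j
    found-a = cubeRoot-avoiding {ε} f (*-nonzero (^-nonzero q xi≢0) (support xi≢0))
    a = proj₁ found-a
    a+ā≡1 : a + a ^ q ≡ 1#
    a+ā≡1 = proj₁ (proj₁ (proj₂ found-a))
    aā≡1 : a * a ^ q ≡ 1#
    aā≡1 = proj₂ (proj₁ (proj₂ found-a))
    -- `β` is chosen so that `β ^ q * lookup y k` is `g`. Then `⟨ y , u ⟩ = ε + f + g = (1 + a) ε`,
    -- and `a (1 + a) = a * a ^ q = 1` yields the coefficient `ε`. The choice of `a` keeps `g`,
    -- hence `β`, nonzero.
    g β : Carrier
    g = f + a * ε
    β = g ^ q * lookup y k
    g≢0 : g ≢ 0#
    g≢0 = proj₂ (proj₂ found-a)
    β≢0 : β ≢ 0#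
    β≢0 = *-nonzero (^-nonzero q g≢0) yk≢0
    -- Agreeing with `x` at `i` and `j` gives `⟨ x , u ⟩ = 1 + 1 = 0`, so `x` is fixed; the third
    -- nonzero coordinate makes `⟨ u , u ⟩ = 1`.
    u y′ : Vector
    u = lookup x i *ᵛ e i +ᵛ lookup x j *ᵛ e j +ᵛ β *ᵛ e k
    y′ = reflect u a y
    apart : ∀ {i j} → lookup x i ≢ 0# → lookup x j ≡ 0# → i ≢ j
    apart xi≢0 xj≡0 refl = xi≢0 xj≡0
    form-u : ∀ z → ⟨ z , u ⟩ ≡ lookup x i ^ q * lookup z i + lookup x j ^ q * lookup z j + β ^ q * lookup z k
    form-u z = trans (form-+ʳ (lookup x i *ᵛ e i +ᵛ lookup x j *ᵛ e j) (β *ᵛ e k) z) (cong₂ _+_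
      (trans (form-+ʳ (lookup x i *ᵛ e i) (lookup x j *ᵛ e j) z) (cong₂ _+_ (form-*eʳ z (lookup x i) i) (form-*eʳ z (lookup x j) j)))
      (form-*eʳ z β k))
    lookup-u : ∀ m {a b c} → lookup (lookup x i *ᵛ e i) m ≡ a → lookup (lookup x j *ᵛ e j) m ≡ b → lookup (β *ᵛ e k) m ≡ c → lookup u m ≡ a + b + c
    lookup-u m a b c =
      trans (lookup-+ᵛ (lookup x i *ᵛ e i +ᵛ lookup x j *ᵛ e j) (β *ᵛ e k) m) (cong₂ _+_ (trans (lookup-+ᵛ (lookup x i *ᵛ e i) (lookup x j *ᵛ e j) m) (cong₂ _+_ a b)) c)
    ui : lookup u i ≡ lookup x i
    ui =
      trans (lookup-u i (lookup-*e-refl _ i) (lookup-*e-distinct _ j≢i) (lookup-*e-distinct _ (apart xi≢0 xk≡0 ∘ sym)))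
      (solve 1 (λ x → x :+ con false :+ con false := x) refl (lookup x i))
    uj : lookup u j ≡ lookup x j
    uj =
      trans (lookup-u j (lookup-*e-distinct _ (j≢i ∘ sym)) (lookup-*e-refl _ j) (lookup-*e-distinct _ (apart xj≢0 xk≡0 ∘ sym)))
      (solve 1 (λ x → con false :+ x :+ con false := x) refl (lookup x j))
    uk : lookup u k ≡ β
    uk =
      trans (lookup-u k (lookup-*e-distinct _ (apart xi≢0 xk≡0)) (lookup-*e-distinct _ (apart xj≢0 xk≡0)) (lookup-*e-refl _ k))
      (solve 1 (λ x → con false :+ con false :+ x := x) refl β)
    ul : lookup u l ≡ 0#
    ul =
      trans (lookup-u l (lookup-*e-distinct _ (apart xi≢0 xl≡0)) (lookup-*e-distinct _ (apart xj≢0 xl≡0)) (lookup-*e-distinct _ (l≢k ∘ sym)))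
      (solve 0 (con false :+ con false :+ con false := con false) refl)
    uu≡1 : ⟨ u , u ⟩ ≡ 1#
    uu≡1 = begin
      ⟨ u , u ⟩                                                                             ≡⟨ form-u u ⟩
      lookup x i ^ q * lookup u i + lookup x j ^ q * lookup u j + β ^ q * lookup u k
        ≡⟨ cong₂ _+_ (cong₂ _+_ (trans (cong (lookup x i ^ q *_) ui) (conj-norm≡1 xi≢0)) (trans (cong (lookup x j ^ q *_) uj) (conj-norm≡1 xj≢0))) (trans (cong (β ^ q *_) uk) (conj-norm≡1 β≢0)) ⟩
      1# + 1# + 1#
        ≡⟨ solve 0 (con true :+ con true :+ con true := con true) refl ⟩
      1#                                                                                    ∎
    xu≡0 : ⟨ x , u ⟩ ≡ 0#
    xu≡0 = begin
      ⟨ x , u ⟩                                                                             ≡⟨ form-u x ⟩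
      lookup x i ^ q * lookup x i + lookup x j ^ q * lookup x j + β ^ q * lookup x k
        ≡⟨ cong₂ _+_ (cong₂ _+_ (conj-norm≡1 xi≢0) (conj-norm≡1 xj≢0)) (cong (β ^ q *_) xk≡0) ⟩
      1# + 1# + β ^ q * 0#
        ≡⟨ solve 1 (λ b → con true :+ con true :+ b :* con false := con false) refl (β ^ q) ⟩
      0#                                                                                    ∎
    β̄yk≡g : β ^ q * lookup y k ≡ g
    β̄yk≡g = begin
      (g ^ q * lookup y k) ^ q * lookup y k
        ≡⟨ cong (_* lookup y k) (trans (^-distrib-* (g ^ q) (lookup y k) q) (cong (_* lookup y k ^ q) (conj-conj g))) ⟩
      g * lookup y k ^ q * lookup y k                ≡⟨ trans (*-assoc g _ _) (cong (g *_) (conj-norm≡1 yk≢0)) ⟩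
      g * 1#                                         ≡⟨ *-identityʳ g ⟩
      g                                              ∎
    a*yu≡ε : a * ⟨ y , u ⟩ ≡ ε
    a*yu≡ε = begin
      a * ⟨ y , u ⟩                ≡⟨ cong (a *_) (trans (form-u y) (cong (ε + f +_) β̄yk≡g)) ⟩
      a * (ε + f + (f + a * ε))
        ≡⟨ solve 4 (λ a b e f → a :* (e :+ f :+ (f :+ a :* e)) := a :* b :* e :+ a :* e :* (con true :+ (a :+ b))) refl a (a ^ q) ε f ⟩
      a * a ^ q * ε + a * ε * (1# + (a + a ^ q)) ≡⟨ cong₂ (λ s t → s * ε + a * ε * (1# + t)) aā≡1 a+ā≡1 ⟩
      1# * ε + a * ε * (1# + 1#)
        ≡⟨ solve 2 (λ a e → con true :* e :+ a :* e :* (con true :+ con true) := e) refl a ε ⟩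
      ε                            ∎
    lookup-y′ : ∀ m → lookup y′ m ≡ lookup y m + ε * lookup u m
    lookup-y′ m = trans (lookup-reflect u a y m) (cong (λ c → lookup y m + c * lookup u m) a*yu≡ε)
    y′i≡0 : lookup y′ i ≡ 0#
    y′i≡0 = begin
      lookup y′ i                                                  ≡⟨ lookup-y′ i ⟩
      lookup y i + ε * lookup u i                                  ≡⟨ cong (λ c → lookup y i + ε * c) ui ⟩
      lookup y i + lookup x i ^ q * lookup y i * lookup x i
        ≡⟨ solve 3 (λ y c x → y :+ c :* y :* x := y :+ c :* x :* y) refl (lookup y i) (lookup x i ^ q) (lookup x i) ⟩
      lookup y i + lookup x i ^ q * lookup x i * lookup y i
        ≡⟨ cong (λ c → lookup y i + c * lookup y i) (conj-norm≡1 xi≢0) ⟩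
      lookup y i + 1# * lookup y i
        ≡⟨ solve 1 (λ y → y :+ con true :* y := con false) refl (lookup y i) ⟩
      0#                                                           ∎
    y′l≢0 : lookup y′ l ≢ 0#
    y′l≢0 ≡0 = yl≢0 $ begin
      lookup y l                     ≡⟨ +-identityʳ _ ⟨
      lookup y l + 0#                ≡⟨ cong (lookup y l +_) (trans (cong (ε *_) ul) (zeroʳ ε)) ⟨
      lookup y l + ε * lookup u l    ≡⟨ lookup-y′ l ⟨
      lookup y′ l                    ≡⟨ ≡0 ⟩
      0#                             ∎
    cond : a + a ^ q + a * a ^ q * ⟨ u , u ⟩ ≡ 0#
    cond =
      trans (cong₂ _+_ a+ā≡1 (cong₂ _*_ aā≡1 uu≡1)) (solve 0 (con true :+ con true :* con true := con false) refl)
    conj-cond : a ^ q + (a ^ q) ^ q + a ^ q * (a ^ q) ^ q * ⟨ conj u , conj u ⟩ ≡ 0#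
    conj-cond = begin
      a ^ q + (a ^ q) ^ q + a ^ q * (a ^ q) ^ q * ⟨ conj u , conj u ⟩
        ≡⟨ cong₂ (λ b c → a ^ q + b + a ^ q * b * c) (conj-conj a) (form-conjugates u u) ⟩
      a ^ q + a + a ^ q * a * ⟨ u , u ⟩
        ≡⟨ solve 3 (λ a b n → b :+ a :+ b :* a :* n := a :+ b :+ a :* b :* n) refl a (a ^ q) ⟨ u , u ⟩ ⟩
      a + a ^ q + a * a ^ q * ⟨ u , u ⟩                               ≡⟨ cond ⟩
      0#                                                              ∎
    y~y′ : Congruent x y x y′
    y~y′ = subst (λ v → Congruent x y v y′) (reflect-fixed u a x xu≡0) (reflect-congruent u a cond x y)
    conj-y~conj-y′ : Congruent (conj x) (conj y) (conj x) (conj y′)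
    conj-y~conj-y′ = subst₂ (Congruent (conj x) (conj y))
      (trans (sym (conj-reflect u a x)) (cong conj (reflect-fixed u a x xu≡0))) (sym (conj-reflect u a y))
      (reflect-congruent (conj u) (a ^ q) conj-cond (conj x) (conj y))
    y′y′≡0 : ⟨ y′ , y′ ⟩ ≡ 0#
    y′y′≡0 = trans (reflect-isometry u a cond y y) yy≡0

  swap : ∀ x y → Φ x → Φ y → Congruent (conj x) (conj y) y x
  swap x y (x≢0 , xx≡0) (y≢0 , yy≡0)
    with Fin.any? (λ i → ¬? (lookup x i ≟ 0#) ×-dec (lookup y i ≟ 0#)) | Fin.any? (λ i → (lookup x i ≟ 0#) ×-dec ¬? (lookup y i ≟ 0#))
  ... | yes (p , xp≢0 , yp≡0) | yes (r , xr≡0 , yr≢0) = swap-incomparable-support x y xx≡0 yy≡0 xp≢0 yp≡0 xr≡0 yr≢0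
  ... | no  ¬left | no ¬right = swap-equal-support x y xx≡0 yy≡0 (λ i l → ¬left (i , l)) (λ i r → ¬right (i , r))
  ... | no  ¬left | yes (k , xk≡0 , yk≢0) = swap-smaller-support x y xx≡0 yy≡0 x≢0 (λ i l → ¬left (i , l)) k xk≡0 yk≢0
  -- The claim for `(y , x)` is the claim for `(x , y)` with both pairs written in the other order.
  ... | yes (k , xk≢0 , yk≡0) | no ¬right = congruent-swap {conj y} {conj x} {x} {y}
    (swap-smaller-support y x yy≡0 xx≡0 y≢0 (λ { i (yi≢0 , xi≡0) → ¬right (i , xi≡0 , yi≢0) }) k yk≡0 xk≢0)

  -- Reversal of paths

  conj-involutive : ∀ x → conj (conj x) ≡ x
  conj-involutive x =
    lookup-injective λ i → trans (lookup-conj (conj x) i) (trans (cong (_^ q) (lookup-conj x i)) (conj-conj (lookup x i)))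

  conj-0ᵛ : conj 0ᵛ ≡ 0ᵛ
  conj-0ᵛ = trans (Vec.map-replicate (_^ q) 0# n) (cong (Vec.replicate n) 0^q)

  Φ-conj : ∀ x → Φ x → Φ (conj x)
  Φ-conj x (x≢0 , xx≡0) =
    (λ ≡0 → x≢0 (trans (sym (conj-involutive x)) (trans (cong conj ≡0) conj-0ᵛ))) , trans (form-conjugates x x) xx≡0

  0ᵛ-· : ∀ U → 0ᵛ · U ≡ 0ᵛ
  0ᵛ-· U = lookup-injective λ j → begin
    lookup (0ᵛ · U) j                        ≡⟨ lookup-· 0ᵛ U j ⟩
    sum (λ k → lookup 0ᵛ k * U [ k , j ])
      ≡⟨ sum-cong-≗ (λ k → trans (cong (_* U [ k , j ]) (Vec.lookup-replicate k 0#)) (zeroˡ _)) ⟩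
    sum {n} (λ _ → 0#)                       ≡⟨ sum-replicate-zero n ⟩
    0#                                       ≡⟨ Vec.lookup-replicate j 0# ⟨
    lookup 0ᵛ j                              ∎

  Φ-· : ∀ x U → GU U → Φ x → Φ (x · U)
  Φ-· x U u@((V , _) , _) (x≢0 , xx≡0) =
    (λ ≡0 → x≢0 (trans (sym (·-inverse U u x)) (trans (cong (_· V) ≡0) (0ᵛ-· V)))) , trans (form-invariant U u x x) xx≡0

  Φ-congruent : ∀ a b x y → Φ a → Φ b → Congruent a b x y → Φ x × Φ y
  Φ-congruent a b x y a∈Φ b∈Φ (U , u , refl , refl) = Φ-· a U u a∈Φ , Φ-· b U u b∈Φ

  -- If U swaps the conjugates of x and y back to y and x, then z ↦ conj z · U exchanges the two
  -- kinds of paths from x to y.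
  intersectionNumber-≤ : ∀ i j x y → Φ x → Φ y → intersectionNumber i j x y ≤ intersectionNumber j i x y
  intersectionNumber-≤ i j x y x∈Φ y∈Φ = bound (swap x y x∈Φ y∈Φ)
    where
    module i = Orbital i
    module j = Orbital j
    bound : Congruent (conj x) (conj y) y x → intersectionNumber i j x y ≤ intersectionNumber j i x y
    bound (U , u , x̄U≡y , ȳU≡x) = card-≤ vectors
      (λ z → Φ? z ×-dec R? i x z ×-dec R? j z y) (λ z → Φ? z ×-dec R? j x z ×-dec R? i z y)
      (λ z → conj z · U) injective exchange
      where
      injective : ∀ {z z′} → conj z · U ≡ conj z′ · U → z ≡ z′
      injective {z} {z′} eq = trans (sym (conj-involutive z)) (trans (cong conj conj≡) (conj-involutive z′))
        where
        conj≡ : conj z ≡ conj z′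
        conj≡ = trans (sym (·-inverse U u (conj z))) (trans (cong (_· proj₁ (proj₁ u)) eq) (·-inverse U u (conj z′)))
      exchange : ∀ z → Φ z × R i x z × R j z y → Φ (conj z · U) × R j x (conj z · U) × R i (conj z · U) y
      -- The swap serves again for the two steps of the path: its inverse takes `(z , y)` to
      -- `(conj y , conj z)`, which `U` takes to `(x , conj z · U)`; likewise for `(x , z)`.
      exchange z (z∈Φ , ixz , jzy) = Φ-· (conj z) U u (Φ-conj z z∈Φ) ,
        congruent-trans {j.a} {j.b} {z} {y} {x} {conj z · U} jzy
          (congruent-trans {z} {y} {conj y} {conj z} {x} {conj z · U}
            (congruent-sym {conj y} {conj z} {z} {y} (swap y z y∈Φ z∈Φ)) (U , u , ȳU≡x , refl)) ,
        congruent-trans {i.a} {i.b} {x} {z} {conj z · U} {y} ixz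
          (congruent-trans {x} {z} {conj z} {conj x} {conj z · U} {y}
            (congruent-sym {conj z} {conj x} {x} {z} (swap z x z∈Φ x∈Φ)) (U , u , refl , x̄U≡y))

  commutative : Commutative
  commutative h i j x y hxy =
    -- The bound holds for `i` and `j` in either order, so an injection is enough.
    ℕ.≤-antisym (intersectionNumber-≤ i j x y x∈Φ y∈Φ) (intersectionNumber-≤ j i x y x∈Φ y∈Φ)
    where
    x∈Φ×y∈Φ = Φ-congruent (Orbital.a h) (Orbital.b h) x y (Orbital.a∈Φ h) (Orbital.b∈Φ h) hxy
    x∈Φ = proj₁ x∈Φ×y∈Φ
    y∈Φ = proj₂ x∈Φ×y∈Φ

open import Data.Nat.Base using (_^_)

theorem4p1 : ∀ (n q : ℕ) → 2 ≤ n → PrimePower q → (F : FiniteField (q ^ 2)) →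
    UnitaryScheme.Commutative n q F ⇔ q ≡ 2
theorem4p1 (suc zero) _ (s≤s ())
theorem4p1 (suc (suc n)) q _ pp F = mk⇔ to (Quaternary.commutative (suc (suc n)) q pp F)
  where
  to : UnitaryScheme.Commutative (suc (suc n)) q F → q ≡ 2
  to comm = decidable-stable (q ℕ.≟ 2) λ q≢2 →
    Noncommutativity.¬commutative n q pp F (ℕ.≤∧≢⇒< (primePower⇒2≤ pp) (q≢2 ∘ sym)) comm
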